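{- Let $\mathbb{K}$ be an algebraically closed field, let $G=(V,A)$ be a connected simple directed graph on vertices $V=\{1,\dots,n\}$ with $n\geq 3$, assume that the characteristic of $\mathbb{K}$ is relatively prime to $n$, and let $\omega\in\mathbb{K}$ be a primitive $n$-th root of unity. Then the graph $G$ is uniquely Hamiltonian if and only if the Hamiltonian ideal $H_G$ is of the form $H_{G,C}$ for some length $n$ cycle $C$.
   Context: $\delta^+(i)$ is the set of vertices $j$ with $(i,j)\in A$; both $(i,j)$ and $(j,i)$ may belong to $A$. The Hamiltonian ideal $H_G\subseteq\mathbb{K}[x_1,\dots,x_n]$ is generated by the polynomials $x_i^n-1$ and $\prod_{j\in\delta^+(i)}(\omega x_i-x_j)$ for $i\in V$. The graph $G$ is called doubly covered if each pair of vertices connected by an arc is also connected by an arc in the opposite direction. (An undirected graph is viewed as the doubly covered directed graph having both arcs for each edge.) A cycle of length $k>2$ in $G$ is expressed as a sequence of arcs $C=\{(v_1,v_2),(v_2,v_3),\dots,(v_k,v_1)\}$ of $G$ with $v_1,\dots,v_k$ distinct. The cycle $C$ is called doubly covered if consecutive vertices in the cycle are connected by arcs of $G$ in both directions; otherwise $C$ is called directed. Cycle ideal: for a cycle $C$ of length $k$ with vertices $v_1,\dots,v_k$ in cyclic order and $\omega$ a primitive $k$-th root of unity (here $k=n$), $H_{G,C}=\langle g_1,\dots,g_k\rangle\subseteq\mathbb{K}[x_{v_1},\dots,x_{v_k}]$, where: - if $C$ is doubly covered, $g_i=x_{v_i}+\frac{\omega^{2+i}-\omega^{2-i}}{\omega^3-\omega}x_{v_{k-1}}+\frac{\omega^{1-i}-\omega^{3+i}}{\omega^3-\omega}x_{v_k}$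 for $1\le i\le k-2$, $g_{k-1}=(x_{v_{k-1}}-\omega x_{v_k})(x_{v_{k-1}}-\omega^{ -1}x_{v_k})$, and $g_k=x_{v_k}^k-1$; - if $C$ is directed, $g_i=x_{v_{k-i}}-\omega^{k-i}x_{v_k}$ for $1\le i\le k-1$, and $g_k=x_{v_k}^k-1$. Uniquely Hamiltonian: a directed graph (resp. doubly covered graph) is called uniquely Hamiltonian if it contains $n$ cycles of length $n$ (resp. $2n$ cycles of length $n$). Here cycles are counted by the ways of writing them down: the $k$ cyclic shifts of a cycle of length $k$ are counted separately, and so are its reversals when every arc of the cycle is bidirectional, so a single cycle counts $k$ or $2k$ times.
   Formalization: A graph counts as uniquely Hamiltonian if it has n cycles of length n, or 2n of them and one is doubly covered, even if the graph itself is not doubly covered; the literal definition fails for the bidirected 5-cycle with an extra one-way chord. -}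

module Defs where

open import Algebra.Bundles using (CommutativeRing; Semiring)
open import Algebra.Structures using (IsCommutativeRing)
open import Data.Fin using (Fin; toℕ; fromℕ; inject₁; opposite)
open import Data.Fin.Properties using (all?)
open import Data.Integer using (ℤ; +_; -[1+_]) renaming (_+_ to _+ℤ_; _-_ to _-ℤ_)
open import Data.List using (List; []; _∷_; _++_; foldr; map; filter; allFin; tabulate)
open import Data.List.Membership.Propositional using (_∈_)
open import Data.Nat using (ℕ; suc; _<_; _∸_; s≤s)
import Data.Nat as ℕ
open import Data.Nat.DivMod using (_mod_)
open import Data.Nat.Divisibility using (_∣_)
open import Data.Product using (∃-syntax; _×_; _,_)
open import Data.Sum using (_⊎_)
open import Function.Bundles using (_⇔_; Bijection)
open import Function.Definitions using (Injective)
open import Level using (_⊔_; 0ℓ) renaming (suc to lsuc)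
open import Relation.Binary using (Rel; Setoid; Decidable)
import Relation.Binary.Construct.On as On
open import Relation.Binary.Construct.Closure.Equivalence using (EqClosure)
open import Relation.Binary.PropositionalEquality using (_≡_; setoid; _→-setoid_)
open import Relation.Nullary using (¬_; Dec; does)
open import Data.Bool using (if_then_else_)
open import Relation.Unary using (Pred)

-- The value of _⁻¹ at 0# is unconstrained.
record Field c ℓ : Set (lsuc (c ⊔ ℓ)) where
  field
    commutativeRing : CommutativeRing c ℓ
  open CommutativeRing commutativeRing public
  field
    _⁻¹      : Carrier → Carrier
    inverseʳ : ∀ {x} → ¬ x ≈ 0# → x * x ⁻¹ ≈ 1#
    1≉0      : ¬ 1# ≈ 0#

  open import Algebra.Definitions.RawSemiring (Semiring.rawSemiring semiring) public
    using (_^_; sum) renaming (_×_ to _·_)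

  infixl 7 _/_
  _/_ : Carrier → Carrier → Carrier
  x / y = x * y ⁻¹

  infixr 8 _^ℤ_
  _^ℤ_ : Carrier → ℤ → Carrier
  x ^ℤ (+ m)    = x ^ m
  x ^ℤ -[1+ m ] = (x ⁻¹) ^ suc m

module _ {c ℓ} (K : Field c ℓ) where
  open Field K

  -- a lists the coefficients of a univariate polynomial of degree
  -- exactly suc d, constant term first.
  AlgebraicallyClosed : Set (c ⊔ ℓ)
  AlgebraicallyClosed =
    ∀ d (a : Fin (suc (suc d)) → Carrier) → ¬ a (fromℕ (suc d)) ≈ 0# →
    ∃[ x ] sum (λ i → a i * x ^ toℕ i) ≈ 0#

  -- As 0 ∣ m only for m = 0, this covers characteristic 0 as well.
  HasCharacteristic : ℕ → Set ℓ
  HasCharacteristic p = ∀ m → (m · 1# ≈ 0#) ⇔ (p ∣ m)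

  PrimitiveRoot : ℕ → Carrier → Set ℓ
  PrimitiveRoot n ω = ω ^ n ≈ 1# × (∀ m → 0 < m → m < n → ¬ ω ^ m ≈ 1#)

-- The polynomial ring K[x₁,…,xₙ], presented as the free commutative
-- K-algebra on n generators: formal expressions, identified by the least
-- congruence containing the commutative ring laws and making con a ring
-- homomorphism.

module Polynomials {c ℓ} (K : Field c ℓ) (n : ℕ) where
  private module K = Field K

  infixl 6 _⊕_
  infixl 7 _⊗_
  infix  4 _≋_

  data Poly : Set c where
    con     : K.Carrier → Poly
    var     : Fin n → Poly
    _⊕_ _⊗_ : Poly → Poly → Poly
    ⊖_      : Poly → Poly

  data _≋_ : Rel Poly (c ⊔ ℓ) where
    ≋-refl  : ∀ {p} → p ≋ p
    ≋-sym   : ∀ {p q} → p ≋ q → q ≋ p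
    ≋-trans : ∀ {p q r} → p ≋ q → q ≋ r → p ≋ r

    con-cong : ∀ {a b} → a K.≈ b → con a ≋ con b
    ⊕-cong   : ∀ {p p′ q q′} → p ≋ p′ → q ≋ q′ → p ⊕ q ≋ p′ ⊕ q′
    ⊗-cong   : ∀ {p p′ q q′} → p ≋ p′ → q ≋ q′ → p ⊗ q ≋ p′ ⊗ q′
    ⊖-cong   : ∀ {p q} → p ≋ q → ⊖ p ≋ ⊖ q

    con-+ : ∀ a b → con (a K.+ b) ≋ con a ⊕ con b
    con-* : ∀ a b → con (a K.* b) ≋ con a ⊗ con b

    ⊕-assoc     : ∀ p q r → (p ⊕ q) ⊕ r ≋ p ⊕ (q ⊕ r)
    ⊕-comm      : ∀ p q → p ⊕ q ≋ q ⊕ p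
    ⊕-identityˡ : ∀ p → con K.0# ⊕ p ≋ p
    ⊖-inverseˡ  : ∀ p → ⊖ p ⊕ p ≋ con K.0#
    ⊗-assoc     : ∀ p q r → (p ⊗ q) ⊗ r ≋ p ⊗ (q ⊗ r)
    ⊗-comm      : ∀ p q → p ⊗ q ≋ q ⊗ p
    ⊗-identityˡ : ∀ p → con K.1# ⊗ p ≋ p
    ⊗-distribˡ  : ∀ p q r → p ⊗ (q ⊕ r) ≋ p ⊗ q ⊕ p ⊗ r

  isCommutativeRing : IsCommutativeRing _≋_ _⊕_ _⊗_ ⊖_ (con K.0#) (con K.1#)
  isCommutativeRing = record
    { isRing = record
      { +-isAbelianGroup = record
        { isGroup = record
          { isMonoid = record
            { isSemigroup = record
              { isMagma = record
                { isEquivalence = record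
                  { refl = ≋-refl ; sym = ≋-sym ; trans = ≋-trans }
                ; ∙-cong = ⊕-cong
                }
              ; assoc = ⊕-assoc
              }
            ; identity = ⊕-identityˡ
                       , λ p → ≋-trans (⊕-comm p _) (⊕-identityˡ p)
            }
          ; inverse = ⊖-inverseˡ
                    , λ p → ≋-trans (⊕-comm p _) (⊖-inverseˡ p)
          ; ⁻¹-cong = ⊖-cong
          }
        ; comm = ⊕-comm
        }
      ; *-cong = ⊗-cong
      ; *-assoc = ⊗-assoc
      ; *-identity = ⊗-identityˡ
                   , λ p → ≋-trans (⊗-comm p _) (⊗-identityˡ p)
      ; distrib = ⊗-distribˡ
                , λ p q r → ≋-trans (⊗-comm (q ⊕ r) p)
                              (≋-trans (⊗-distribˡ p q r)
                                (⊕-cong (⊗-comm p q) (⊗-comm p r)))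
      }
    ; *-comm = ⊗-comm
    }

  polynomialRing : CommutativeRing c (c ⊔ ℓ)
  polynomialRing = record { isCommutativeRing = isCommutativeRing }

module _ {c ℓ} (R : CommutativeRing c ℓ) where
  open CommutativeRing R using (Carrier; _≈_; _+_; _*_; 0#)

  data ⟨_⟩ (gs : List Carrier) : Pred Carrier (c ⊔ ℓ) where
    generator : ∀ {g} → g ∈ gs → ⟨ gs ⟩ g
    zero      : ⟨ gs ⟩ 0#
    add       : ∀ {f g} → ⟨ gs ⟩ f → ⟨ gs ⟩ g → ⟨ gs ⟩ (f + g)
    multiply  : ∀ f {g} → ⟨ gs ⟩ g → ⟨ gs ⟩ (f * g)
    respects  : ∀ {f g} → f ≈ g → ⟨ gs ⟩ f → ⟨ gs ⟩ g

-- Simple: no loops, and at most one arc for each ordered pair.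
record SimpleDigraph (n : ℕ) : Set₁ where
  field
    Arc      : Rel (Fin n) 0ℓ
    arc?     : Decidable Arc
    loopless : ∀ i → ¬ Arc i i

  -- Paths may use arcs in either direction.
  Connected : Set
  Connected = ∀ i j → EqClosure Arc i j

  δ⁺ : Fin n → List (Fin n)
  δ⁺ i = filter (arc? i) (allFin n)

next : ∀ {k} → Fin k → Fin k
next {suc m} i = suc (toℕ i) mod suc m

module _ {n : ℕ} (G : SimpleDigraph n) where
  open SimpleDigraph G

  -- A cycle as it is written down, v₁,…,vₖ, where vᵢ₊₁ = vertex i.
  record Cycle (k : ℕ) : Set where
    field
      vertex   : Fin k → Fin n
      2<k      : 2 < k
      distinct : Injective _≡_ _≡_ vertex
      arcs     : ∀ i → Arc (vertex i) (vertex (next i))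

  open Cycle

  -- The reversed arcs suffice, the forward ones being part of the cycle.
  DoublyCovered : ∀ {k} → Cycle k → Set
  DoublyCovered C = ∀ i → Arc (vertex C (next i)) (vertex C i)

  doublyCovered? : ∀ {k} (C : Cycle k) → Dec (DoublyCovered C)
  doublyCovered? C = all? (λ i → arc? (vertex C (next i)) (vertex C i))

  -- Cycles are equal when they have the same sequence of vertices, so
  -- shifts and reversals of a cycle are distinct from it.
  cycleSetoid : ℕ → Setoid 0ℓ 0ℓ
  cycleSetoid k = On.setoid (Fin k →-setoid Fin n) (vertex {k})

  NumberOfCycles : (k m : ℕ) → Set
  NumberOfCycles k m = Bijection (setoid (Fin m)) (cycleSetoid k)

  -- G has a single cycle of length n up to rewriting it, counted n times if
  -- directed and 2n times if doubly covered.  If G itself is doubly covered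
  -- then so is each of its cycles, and the condition reads "2n cycles".  A
  -- graph whose only cycle of length n is doubly covered qualifies even if
  -- it also has one-way arcs off the cycle.  The doubly covered cycle is
  -- demanded in the second case because 2n is also the count for two
  -- unrelated directed cycles.
  UniquelyHamiltonian : Set
  UniquelyHamiltonian =
    NumberOfCycles n n
    ⊎ (NumberOfCycles n (2 ℕ.* n) × ∃[ C ] DoublyCovered {n} C)

module Ideals {c ℓ} (K : Field c ℓ) {n : ℕ} (G : SimpleDigraph n)
              (ω : Field.Carrier K) where
  open SimpleDigraph G
  open Polynomials K n using (Poly; con; var; polynomialRing)
  open CommutativeRing polynomialRing using (_+_; _-_; _*_; 1#; semiring)
  open import Algebra.Definitions.RawSemiring (Semiring.rawSemiring semiring) using (_^_)
  private module K = Field K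

  hamiltonianIdeal : Pred Poly (c ⊔ ℓ)
  hamiltonianIdeal = ⟨_⟩ polynomialRing
    (  tabulate (λ i → var i ^ n - 1#)
    ++ tabulate (λ i → foldr _*_ 1# (map (λ j → con ω * var i - var j) (δ⁺ i))))

  -- The linear generators for i = 1,…,k-2 are indexed by i - 1 : Fin (k-2),
  -- while v counts from 0.
  doublyCoveredGenerators : ∀ {k} → 2 < k → (Fin k → Fin n) → List Poly
  doublyCoveredGenerators {suc (suc m)} (s≤s (s≤s _)) v =
       tabulate (λ (j : Fin m) → let i = + suc (toℕ j) in
           x (inject₁ (inject₁ j))
         + con ((ω ^ℤ (+ 2 +ℤ i) K.- ω ^ℤ (+ 2 -ℤ i)) / (ω K.^ 3 K.- ω)) * xₖ₋₁
         + con ((ω ^ℤ (+ 1 -ℤ i) K.- ω ^ℤ (+ 3 +ℤ i)) / (ω K.^ 3 K.- ω)) * xₖ)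
    ++ (xₖ₋₁ - con ω * xₖ) * (xₖ₋₁ - con (ω ⁻¹) * xₖ)
     ∷ xₖ ^ suc (suc m) - 1#
     ∷ []
    where
    open Field K using (_^ℤ_; _/_; _⁻¹)
    x : Fin (suc (suc m)) → Poly
    x j = var (v j)
    xₖ₋₁ xₖ : Poly
    xₖ₋₁ = x (inject₁ (fromℕ m))
    xₖ   = x (fromℕ (suc m))

  -- The linear generators for i = 1,…,k-1 are indexed by i - 1 : Fin (k-1);
  -- the index of v_{k-i}, counted from 0, is (k-1) - 1 - (i-1).
  directedGenerators : ∀ {k} → 2 < k → (Fin k → Fin n) → List Poly
  directedGenerators {suc m} (s≤s _) v =
       tabulate (λ (j : Fin m) →
         x (inject₁ (opposite j)) - con (ω K.^ (suc m ∸ suc (toℕ j))) * xₖ)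
    ++ xₖ ^ suc m - 1#
     ∷ []
    where
    x : Fin (suc m) → Poly
    x j = var (v j)
    xₖ : Poly
    xₖ = x (fromℕ m)

  -- For k = n the variables of the cycle are all the variables.
  cycleIdeal : Cycle G n → Pred Poly (c ⊔ ℓ)
  cycleIdeal C = ⟨_⟩ polynomialRing
    (if does (doublyCovered? G C)
      then doublyCoveredGenerators (Cycle.2<k C) (Cycle.vertex C)
      else directedGenerators      (Cycle.2<k C) (Cycle.vertex C))

-- Every xᵢ is an n-th root of unity modulo either ideal, so by the Lagrange
-- idempotents of xⁿ = 1 (which need 1/n) an ideal containing all xᵢⁿ - 1 is
-- determined by its zeros (ω^a₁,…,ω^aₙ).  The zeros of the Hamiltonian ideal are
-- the labellings a of V by ℤ/n in which every i has an out-neighbour labelled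
-- a i + 1, i.e. the positions of the vertices on the Hamiltonian cycles.  The
-- zeros of the ideal of a cycle C come from rewriting C: its shifts, and its
-- reversals if C is doubly covered.  So the two ideals agree iff every
-- Hamiltonian cycle rewrites C, and counting the rewritings of C gives n or 2n.

module Submission where

open import Defs
open import Algebra.Bundles using (CommutativeRing; Semiring)
import Algebra.Definitions.RawSemiring
open import Data.Bool using (if_then_else_)
open import Data.Fin using (Fin; zero; suc; toℕ; fromℕ; inject₁; opposite; punchOut; remQuot; combine)
open import Data.Fin.Induction using (<-weakInduction; >-weakInduction)
open import Data.Fin.Patterns using (0F; 1F)
open import Data.Fin.Properties
  using (_≟_; all?; any?; ¬∀⟶∃¬; toℕ-injective; toℕ-fromℕ<; toℕ-inject₁; toℕ-fromℕ; toℕ<n;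
         punchOut-injective; injective⇒≤; opposite-involutive; opposite-prop;
         combine-remQuot; remQuot-combine)
open import Data.Fin.Relation.Unary.Top using (view; ‵fromℕ; ‵inject₁)
open import Data.Integer using (+_; _⊖_)
import Data.Integer as ℤ
import Data.Integer.Properties as ℤ
open import Data.List using (List; []; _∷_; _++_; foldr; map; allFin; tabulate)
open import Data.List.Membership.Propositional using (_∈_)
open import Data.List.Membership.Propositional.Properties
  using (∈-tabulate⁺; ∈-++⁺ˡ; ∈-++⁺ʳ; ∈-filter⁺; ∈-filter⁻; ∈-allFin)
open import Data.List.Relation.Unary.All using (All; []; _∷_)
import Data.List.Relation.Unary.All as All
import Data.List.Relation.Unary.All.Properties as All
open import Data.List.Relation.Unary.Any using (here; there)
open import Data.Nat using (ℕ; zero; suc; _≤_; _<_; s≤s; z<s; s<s; _∸_)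
import Data.Nat as ℕ
open import Data.Nat.Coprimality using (Coprime)
open import Data.Nat.DivMod using (_%_; m<n⇒m%n≡m; n%n≡0; m≡m%n+[m/n]*n; m%n<n)
open import Data.Nat.Divisibility using (_∣_; divides-refl; ∣-refl; m%n≡0⇒n∣m)
open import Data.Nat.GeneralisedArithmetic using (fold)
open import Data.Nat.Induction using (<-rec)
import Data.Nat.Properties as ℕ
open import Data.Product using (∃-syntax; _,_; proj₁; proj₂; _×_; map₂; uncurry)
open import Data.Sum using (_⊎_; inj₁; inj₂; [_,_]′)
  renaming (map to ⊎-map; map₂ to ⊎-map₂)
open import Data.Vec.Functional using () renaming (_∷_ to _▹_)
open import Function using (_∘_; id)
open import Function.Bundles using (_⇔_; mk⇔; Bijection)
open import Function.Definitions using (Injective)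
open import Level using (_⊔_)
open import Relation.Binary.Bundles using (Setoid)
open import Relation.Binary.Definitions using (tri<; tri≈; tri>)
open import Relation.Binary.PropositionalEquality as ≡ using (_≡_; _≢_; _≗_; cong; subst)
open import Relation.Nullary using (¬_; Dec; does; yes; no; contradiction; _×-dec_; toSum)
open import Relation.Nullary.Decidable using (decidable-stable)
open import Relation.Unary using (Pred; _⊆_; _≐_)

-- Equality in `K` is not decidable, so zeros are carried as labellings `a : Fin n → Fin n`,
-- standing for the points `pow ∘ a`. As `pow` is injective, case distinctions about values, such as
-- which factor of a product vanishes, are made in `Fin n`. Points are modelled inside the quotient
-- ring by an element `e` on which every variable acts as a scalar: every polynomial then acts on
-- `e` as its value at that point. For the Hamiltonian ideal, `e` is a product of Lagrange
-- projections over all variables, and it is 0 if its point is not a zero, because some generator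
-- acts on it as a nonzero constant. In a cycle ideal the projections of the last variable nearly
-- suffice, since the linear generators determine the rest. The doubly covered case leaves two
-- values for the last but one variable; multiplying by one factor of the quadratic selects the root
-- of the other. From a count back to uniqueness the tool is the pigeonhole principle: n or 2n
-- different rewritings exhaust a set of that size. The bound n > 2 keeps shifts apart from
-- reversals, and ω apart from ω⁻¹.

-- The cyclic order on `Fin n`: rotations, reflections, pigeonhole.

module CyclicOrder where
  open ≡ using (refl; sym; trans; setoid; module ≡-Reasoning)

  -- If `y` were missed, punching it out would squeeze `Fin (suc m)` injectively into `Fin m`.
  injective⇒surjective : ∀ {n} {f : Fin n → Fin n} → Injective _≡_ _≡_ f →
                         ∀ y → ∃[ x ] f x ≡ y
  injective⇒surjective {suc m} {f} inj y with any? (λ x → f x ≟ y)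
  ... | yes hit  = hit
  ... | no  miss = contradiction (injective⇒≤ avoid-injective) ℕ.1+n≰n
    where
    avoid : Fin (suc m) → Fin m
    avoid x = punchOut {i = y} {f x} (λ eq → miss (x , sym eq))
    avoid-injective : Injective _≡_ _≡_ avoid
    avoid-injective = inj ∘ punchOut-injective {i = y} _ _

  toℕ-next : ∀ {m} (i : Fin (suc m)) → toℕ (next i) ≡ suc (toℕ i) % suc m
  toℕ-next i = toℕ-fromℕ< _

  next-inject₁ : ∀ {m} (i : Fin m) → next (inject₁ i) ≡ suc i
  next-inject₁ {m} i = toℕ-injective (begin
    toℕ (next (inject₁ i))         ≡⟨ toℕ-next (inject₁ i) ⟩
    suc (toℕ (inject₁ i)) % suc m  ≡⟨ cong (λ k → suc k % suc m) (toℕ-inject₁ i) ⟩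
    suc (toℕ i) % suc m            ≡⟨ m<n⇒m%n≡m (s≤s (toℕ<n i)) ⟩
    suc (toℕ i)                    ∎)
    where open ≡-Reasoning

  next-fromℕ : ∀ m → next (fromℕ m) ≡ zero
  next-fromℕ m = toℕ-injective (begin
    toℕ (next (fromℕ m))         ≡⟨ toℕ-next (fromℕ m) ⟩
    suc (toℕ (fromℕ m)) % suc m  ≡⟨ cong (λ k → suc k % suc m) (toℕ-fromℕ m) ⟩
    suc m % suc m                ≡⟨ n%n≡0 (suc m) ⟩
    0                            ∎)
    where open ≡-Reasoning

  prev : ∀ {m} → Fin (suc m) → Fin (suc m)
  prev zero    = fromℕ _
  prev (suc i) = inject₁ i

  prev-next : ∀ {m} (i : Fin (suc m)) → prev (next i) ≡ i
  prev-next i with view i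
  ... | ‵fromℕ     = cong prev (next-fromℕ _)
  ... | ‵inject₁ j = cong prev (next-inject₁ j)

  next-prev : ∀ {m} (i : Fin (suc m)) → next (prev i) ≡ i
  next-prev zero    = next-fromℕ _
  next-prev (suc i) = next-inject₁ i

  next-injective : ∀ {m} → Injective _≡_ _≡_ (next {suc m})
  next-injective {_} {i} {j} eq = trans (sym (prev-next i)) (trans (cong prev eq) (prev-next j))

  module _ {m p} (P : Fin (suc m) → Set p) (step : ∀ i → P i → P (next i)) where

    next-induction : P zero → ∀ i → P i
    next-induction P₀ = <-weakInduction P P₀ (λ i → subst P (next-inject₁ i) ∘ step (inject₁ i))

    -- A single orbit: climb from `i` to the last element, wrap around to `zero`, and climb again.
    next-inductionFrom : ∀ i → P i → ∀ j → P j
    next-inductionFrom i Pᵢ = next-induction (subst P (next-fromℕ m) (step _ (toLast i Pᵢ)))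
      where
      toLast : ∀ i → P i → P (fromℕ m)
      toLast = >-weakInduction _ id (λ i → _∘ subst P (next-inject₁ i) ∘ step (inject₁ i))


  -- In ℤ/n, `opposite` is i ↦ -1 - i; this is what makes it exchange rotations and reflections
  -- below.
  next-opposite-next : ∀ {m} (i : Fin (suc m)) → next (opposite (next i)) ≡ opposite i
  next-opposite-next {m} i with view i
  ... | ‵fromℕ     = begin
    next (opposite (next (fromℕ m))) ≡⟨ cong (next ∘ opposite) (next-fromℕ m) ⟩
    next (fromℕ m)                   ≡⟨ next-fromℕ m ⟩
    zero                             ≡⟨ opposite-involutive zero ⟨
    opposite (fromℕ m)               ∎
    where open ≡-Reasoning
  ... | ‵inject₁ j = begin
    next (opposite (next (inject₁ j))) ≡⟨ cong (next ∘ opposite) (next-inject₁ j) ⟩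
    next (inject₁ (opposite j))        ≡⟨ next-inject₁ (opposite j) ⟩
    suc (opposite j)                   ≡⟨ opposite-involutive _ ⟨
    opposite (opposite (suc (opposite j)))     ≡⟨ cong (opposite ∘ inject₁) (opposite-involutive j) ⟩
    opposite (inject₁ j)               ∎
    where open ≡-Reasoning

  -- In ℤ/n these are the maps i ↦ c + i and i ↦ c - i; the second is written as f (i + 1) + 1 = f i
  -- to avoid a predecessor.
  Rotation Reflection : ∀ {n} → (Fin n → Fin n) → Set
  Rotation   f = ∀ i → f (next i) ≡ next (f i)
  Reflection f = ∀ i → next (f (next i)) ≡ f i

  rotation-resp-≗ : ∀ {n} {f g : Fin n → Fin n} → f ≗ g → Rotation f → Rotation g
  rotation-resp-≗ f≗g f-rot i =
    trans (sym (f≗g (next i))) (trans (f-rot i) (cong next (f≗g i)))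

  reflection-resp-≗ : ∀ {n} {f g : Fin n → Fin n} → f ≗ g → Reflection f → Reflection g
  reflection-resp-≗ f≗g f-ref i =
    trans (cong next (sym (f≗g (next i)))) (trans (f-ref i) (f≗g i))

  rotate : ∀ {n} → Fin n → Fin n → Fin n
  rotate c i = fold i next (toℕ c)

  rotate-rotation : ∀ {n} (c : Fin n) → Rotation (rotate c)
  rotate-rotation c i = fold-next (toℕ c)
    where
    fold-next : ∀ k → fold (next i) next k ≡ next (fold i next k)
    fold-next zero    = refl
    fold-next (suc k) = cong next (fold-next k)

  rotate-zero : ∀ {m} (c : Fin (suc m)) → rotate c zero ≡ c
  rotate-zero = <-weakInduction (λ c → rotate c zero ≡ c) refl λ i eq → begin
    next (fold zero next (toℕ i))           ≡⟨ cong (next ∘ fold zero next) (toℕ-inject₁ i) ⟨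
    next (fold zero next (toℕ (inject₁ i))) ≡⟨ cong next eq ⟩
    next (inject₁ i)                        ≡⟨ next-inject₁ i ⟩
    suc i                                   ∎
    where open ≡-Reasoning

  rotation-unique : ∀ {m} {f g : Fin (suc m) → Fin (suc m)} → Rotation f → Rotation g →
                    f zero ≡ g zero → f ≗ g
  rotation-unique {f = f} {g} f-rot g-rot =
    next-induction (λ i → f i ≡ g i) λ i eq →
      trans (f-rot i) (trans (cong next eq) (sym (g-rot i)))

  rotation≗rotate : ∀ {m} {f : Fin (suc m) → Fin (suc m)} → Rotation f → f ≗ rotate (f zero)
  rotation≗rotate {f = f} f-rot =
    rotation-unique f-rot (rotate-rotation (f zero)) (sym (rotate-zero (f zero)))

  rotation∘opposite : ∀ {n} {f : Fin n → Fin n} → Rotation f → Reflection (f ∘ opposite)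
  rotation∘opposite {suc m} {f} f-rot i =
    trans (sym (f-rot _)) (cong f (next-opposite-next i))

  reflection∘opposite : ∀ {n} {f : Fin n → Fin n} → Reflection f → Rotation (f ∘ opposite)
  reflection∘opposite {suc m} {f} f-ref i = begin
    f (opposite (next i))               ≡⟨ f-ref _ ⟨
    next (f (next (opposite (next i)))) ≡⟨ cong (next ∘ f) (next-opposite-next i) ⟩
    next (f (opposite i))               ∎
    where open ≡-Reasoning

  module _ {n} {f g : Fin n → Fin n} (g∘f : ∀ i → g (f i) ≡ i) where

    private
      leftInvertible⇒injective : Injective _≡_ _≡_ f
      leftInvertible⇒injective {i} {j} eq = trans (sym (g∘f i)) (trans (cong g eq) (g∘f j))

    -- `f` is injective, hence onto, so `g` need only be examined on values of `f`.
    leftInverse-rotation : Rotation f → Rotation g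
    leftInverse-rotation f-rot i with j , refl ← injective⇒surjective leftInvertible⇒injective i = begin
      g (next (f j)) ≡⟨ cong g (f-rot j) ⟨
      g (f (next j)) ≡⟨ g∘f (next j) ⟩
      next j         ≡⟨ cong next (g∘f j) ⟨
      next (g (f j)) ∎
      where open ≡-Reasoning

    leftInverse-reflection : Reflection f → Reflection g
    leftInverse-reflection f-ref i
      with j , eq ← injective⇒surjective leftInvertible⇒injective (next i) = begin
      next (g (next i)) ≡⟨ cong (next ∘ g) eq ⟨
      next (g (f j))    ≡⟨ cong next (g∘f j) ⟩
      next j            ≡⟨ g∘f (next j) ⟨
      g (f (next j))    ≡⟨ cong g (nextInjective n (trans (f-ref j) eq)) ⟩
      g i               ∎
      where
      open ≡-Reasoning
      nextInjective : ∀ k → Injective _≡_ _≡_ (next {k})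
      nextInjective (suc m) = next-injective

  rotate-injective : ∀ {m} (c : Fin (suc m)) → Injective _≡_ _≡_ (rotate c)
  rotate-injective c = fold-injective (toℕ c)
    where
    fold-injective : ∀ k → Injective _≡_ _≡_ (λ i → fold i next k)
    fold-injective zero    = id
    fold-injective (suc k) = fold-injective k ∘ next-injective

  opposite-injective : ∀ {n} → Injective _≡_ _≡_ (opposite {n})
  opposite-injective {_} {i} {j} eq =
    trans (sym (opposite-involutive i)) (trans (cong opposite eq) (opposite-involutive j))

  -- A fixed point of i ↦ i + 2 would spread along `next` to `zero`, but 2 ≠ 0 when n > 2.
  next²-fixpointFree : ∀ {m} → 2 < suc m → (i : Fin (suc m)) → next (next i) ≢ i
  next²-fixpointFree (s≤s (s≤s (s≤s _))) i eq = contradiction zero-fixed λ ()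
    where
    zero-fixed : suc (suc zero) ≡ zero
    zero-fixed = begin
      suc (suc zero)     ≡⟨ next-inject₁ (suc zero) ⟨
      next (suc zero)    ≡⟨ cong next (next-inject₁ zero) ⟨
      next (next zero)   ≡⟨ next-inductionFrom (λ j → next (next j) ≡ j) (λ _ → cong next) i eq zero ⟩
      zero               ∎
      where open ≡-Reasoning

  rotation≢reflection : ∀ {m} {f g : Fin (suc m) → Fin (suc m)} → 2 < suc m →
                        Rotation f → Reflection g → ¬ f ≗ g
  rotation≢reflection {f = f} {g} 2<n f-rot g-ref f≗g = next²-fixpointFree 2<n (f zero) (begin
    next (next (f zero)) ≡⟨ cong next (f-rot zero) ⟨
    next (f (next zero)) ≡⟨ cong next (f≗g (next zero)) ⟩
    next (g (next zero)) ≡⟨ g-ref zero ⟩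
    g zero               ≡⟨ f≗g zero ⟨
    f zero               ∎)
    where open ≡-Reasoning

  module _ {c ℓ} {S : Setoid c ℓ} {k : ℕ} (B : Bijection (setoid (Fin k)) S) where
    private
      module S = Setoid S
      module B = Bijection B

      index : S.Carrier → Fin k
      index y = proj₁ (B.surjective y)

      to-index : ∀ y → B.to (index y) S.≈ y
      to-index y = proj₂ (B.surjective y) refl

      index-injective : Injective S._≈_ _≡_ index
      index-injective {x} {y} eq =
        S.trans (S.sym (to-index x)) (S.trans (B.cong eq) (to-index y))

    -- Pigeonhole for `index ∘ f`, transported along `B`. It turns a count of cycles into the claim
    -- that the known rewritings are all of them.
    finite-injective⇒surjective : {f : Fin k → S.Carrier} → Injective _≡_ S._≈_ f →
                                  ∀ y → ∃[ i ] f i S.≈ y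
    finite-injective⇒surjective f-injective y =
      map₂ index-injective (injective⇒surjective (f-injective ∘ index-injective) (index y))

open CyclicOrder

-- Rewritings of a Hamiltonian cycle, their number, and tours.

module CycleSymmetries {m} (G : SimpleDigraph (suc m)) where
  open ≡ using (refl; sym; trans; setoid; module ≡-Reasoning)
  open SimpleDigraph G
  open Cycle

  private
    n : ℕ
    n = suc m

  label : Cycle G n → Fin n → Fin n
  label C v = proj₁ (injective⇒surjective (distinct C) v)

  vertex-label : ∀ C v → vertex C (label C v) ≡ v
  vertex-label C v = proj₂ (injective⇒surjective (distinct C) v)

  label-vertex : ∀ C i → label C (vertex C i) ≡ i
  label-vertex C i = distinct C (vertex-label C (vertex C i))

  Symmetry : Cycle G n → (Fin n → Fin n) → Set
  Symmetry C f = Rotation f ⊎ (DoublyCovered G C × Reflection f)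

  reindex : ∀ C {f} → Injective _≡_ _≡_ f → Symmetry C f → Cycle G n
  reindex C {f} f-inj _ .vertex        = vertex C ∘ f
  reindex C f-inj _ .2<k               = 2<k C
  reindex C f-inj _ .distinct          = f-inj ∘ distinct C
  reindex C {f} f-inj (inj₁ f-rot) .arcs i =
    subst (Arc _ ∘ vertex C) (sym (f-rot i)) (arcs C (f i))
  reindex C {f} f-inj (inj₂ (dc , f-ref)) .arcs i =
    -- With k = f (i + 1) one has k + 1 = f i, so the reversed arc from k + 1 to k is the one
    -- required.
    subst (λ j → Arc (vertex C j) (vertex C (f (next i)))) (f-ref i) (dc (f (next i)))

  shift : Cycle G n → Fin n → Cycle G n
  shift C c = reindex C (rotate-injective c) (inj₁ (rotate-rotation c))

  shift-injective : ∀ C c d → vertex (shift C c) ≗ vertex (shift C d) → c ≡ d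
  shift-injective C c d eq =
    trans (sym (rotate-zero c)) (trans (distinct C (eq zero)) (rotate-zero d))

  -- Since `opposite` acts first, `c` is the position in `C` of the last vertex written; hence the
  -- `opposite zero` when `c` is recovered from a given cycle.
  reverse : ∀ C → DoublyCovered G C → Fin n → Cycle G n
  reverse C dc c = reindex C (opposite-injective ∘ rotate-injective c)
    (inj₂ (dc , rotation∘opposite (rotate-rotation c)))

  module _ (C : Cycle G n) (dc : DoublyCovered G C) where

    shiftOrReverse : Fin 2 × Fin n → Cycle G n
    shiftOrReverse (0F , c) = shift C c
    shiftOrReverse (1F , c) = reverse C dc c

    shiftOrReverse-injective : ∀ p q →
      vertex (shiftOrReverse p) ≗ vertex (shiftOrReverse q) → p ≡ q
    shiftOrReverse-injective (0F , c) (0F , d) eq = cong (0F ,_) (shift-injective C c d eq)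
    shiftOrReverse-injective (0F , c) (1F , d) eq = contradiction (distinct C ∘ eq)
      (rotation≢reflection (2<k C) (rotate-rotation c) (rotation∘opposite (rotate-rotation d)))
    shiftOrReverse-injective (1F , c) (0F , d) eq = contradiction (distinct C ∘ sym ∘ eq)
      (rotation≢reflection (2<k C) (rotate-rotation d) (rotation∘opposite (rotate-rotation c)))
    shiftOrReverse-injective (1F , c) (1F , d) eq = cong (1F ,_) (shift-injective C c d λ i →
      subst (λ j → vertex C (rotate c j) ≡ vertex C (rotate d j)) (opposite-involutive i)
        (eq (opposite i)))

    shiftsAndReverses : Fin (2 ℕ.* n) → Cycle G n
    shiftsAndReverses = shiftOrReverse ∘ remQuot {2} n

    shiftsAndReverses-injective : ∀ i j →
      vertex (shiftsAndReverses i) ≗ vertex (shiftsAndReverses j) → i ≡ j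
    shiftsAndReverses-injective i j eq = begin
      i                                ≡⟨ combine-remQuot {2} n i ⟨
      uncurry combine (remQuot {2} n i) ≡⟨ cong (uncurry combine)
                                             (shiftOrReverse-injective (remQuot n i) (remQuot n j) eq) ⟩
      uncurry combine (remQuot {2} n j) ≡⟨ combine-remQuot {2} n j ⟩
      j                                ∎
      where open ≡-Reasoning

  -- Phrased by the positions in `D` of the vertices of `C`: with `a = label D` this is the
  -- condition for `a` to be a zero of the ideal of `C`.
  Unique : Cycle G n → Set
  Unique C = ∀ D → Symmetry C (label D ∘ vertex C)

  -- `label D ∘ vertex C` is a left inverse of `f`, and inversion preserves both kinds of symmetry.
  reindexed⇒symmetry : (C D : Cycle G n) {f : Fin n → Fin n} → vertex C ∘ f ≗ vertex D →
                       Symmetry C f → Symmetry C (label D ∘ vertex C)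
  reindexed⇒symmetry C D {f} eq = ⊎-map (leftInverse-rotation cancel) (map₂ (leftInverse-reflection cancel))
    where
    cancel : ∀ i → label D (vertex C (f i)) ≡ i
    cancel i = trans (cong (label D) (eq i)) (label-vertex D i)

  symmetry⇒reindexed : (C D : Cycle G n) →
                       Symmetry C (label D ∘ vertex C) → Symmetry C (label C ∘ vertex D)
  symmetry⇒reindexed C D = ⊎-map (leftInverse-rotation cancel) (map₂ (leftInverse-reflection cancel))
    where
    cancel : ∀ i → label C (vertex D (label D (vertex C i))) ≡ i
    cancel i = trans (cong (label C) (vertex-label D (vertex C i))) (label-vertex C i)

  shift-symmetry : ∀ C D c → vertex (shift C c) ≗ vertex D → Symmetry C (label D ∘ vertex C)
  shift-symmetry C D c eq = reindexed⇒symmetry C D {rotate c} eq (inj₁ (rotate-rotation c))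

  -- The shifts of `C`, or its shifts and reverses, are pairwise different and as many as the
  -- cycles, so every `D` is among them.
  uniquelyHamiltonian⇒unique : UniquelyHamiltonian G → ∃[ C ] Unique C
  uniquelyHamiltonian⇒unique (inj₁ B) = C , λ D →
    let c , eq = finite-injective⇒surjective {S = cycleSetoid G n} B {shift C}
                   (λ {c} {d} → shift-injective C c d) D
    in  shift-symmetry C D c eq
    where C = Bijection.to B zero
  uniquelyHamiltonian⇒unique (inj₂ (B , C , dc)) = C , λ D →
    let i , eq = finite-injective⇒surjective {S = cycleSetoid G n} B {shiftsAndReverses C dc}
                   (λ {i} {j} → shiftsAndReverses-injective C dc i j) D
    in  symmetry (remQuot {2} n i) D eq
    where
    symmetry : ∀ p (D : Cycle G n) → vertex (shiftOrReverse C dc p) ≗ vertex D →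
               Symmetry C (label D ∘ vertex C)
    symmetry (0F , c) D eq = shift-symmetry C D c eq
    symmetry (1F , c) D eq = reindexed⇒symmetry C D {rotate c ∘ opposite} eq
      (inj₂ (dc , rotation∘opposite (rotate-rotation c)))

  rotation⇒shift : (C D : Cycle G n) → Rotation (label C ∘ vertex D) →
                   vertex (shift C (label C (vertex D zero))) ≗ vertex D
  rotation⇒shift C D rot i =
    trans (cong (vertex C) (sym (rotation≗rotate {f = label C ∘ vertex D} rot i)))
          (vertex-label C (vertex D i))

  reflection⇒reverse : (C : Cycle G n) (dc : DoublyCovered G C) (D : Cycle G n) →
                       Reflection (label C ∘ vertex D) →
                       vertex (reverse C dc (label C (vertex D (opposite zero)))) ≗ vertex D
  reflection⇒reverse C dc D ref i = begin
    vertex C (rotate (f (opposite zero)) (opposite i)) ≡⟨ cong (vertex C) (rotation≗rotate {f = f ∘ opposite}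
                                                             (reflection∘opposite {f = f} ref) (opposite i)) ⟨
    vertex C (f (opposite (opposite i)))               ≡⟨ vertex-label C _ ⟩
    vertex D (opposite (opposite i))                   ≡⟨ cong (vertex D) (opposite-involutive i) ⟩
    vertex D i                                         ∎
    where
    open ≡-Reasoning
    f : Fin n → Fin n
    f = label C ∘ vertex D

  numberOfCycles : ∀ {k} (f : Fin k → Cycle G n) →
                   (∀ i j → vertex (f i) ≗ vertex (f j) → i ≡ j) →
                   (∀ D → ∃[ i ] vertex (f i) ≗ vertex D) →
                   NumberOfCycles G n k
  numberOfCycles f f-injective f-surjective = record
    { to        = f
    ; cong      = λ { refl _ → refl }
    ; bijective = (λ {i} {j} → f-injective i j) , λ D →
        let i , eq = f-surjective D in i , λ { refl → eq }
    }

  -- If `C` is not doubly covered only rotations remain, and the n shifts enumerate all cycles;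
  -- otherwise the 2n shifts and reverses do.
  unique⇒uniquelyHamiltonian : ∀ C → Unique C → UniquelyHamiltonian G
  unique⇒uniquelyHamiltonian C unique = [ doubly , directed ]′ (toSum (doublyCovered? G C))
    where
    reindexed : (D : Cycle G n) → Symmetry C (label C ∘ vertex D)
    reindexed D = symmetry⇒reindexed C D (unique D)

    directed : ¬ DoublyCovered G C → UniquelyHamiltonian G
    directed ¬dc = inj₁ (numberOfCycles (shift C) (shift-injective C) λ D →
      label C (vertex D zero) ,
      rotation⇒shift C D ([ id , (λ (dc , _) → contradiction dc ¬dc) ]′ (reindexed D)))

    doubly : DoublyCovered G C → UniquelyHamiltonian G
    doubly dc = inj₂ (numberOfCycles (shiftsAndReverses C dc) (shiftsAndReverses-injective C dc)
      (λ D → [ reachBy (0F , label C (vertex D zero)) D ∘ rotation⇒shift C D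
             , reachBy (1F , label C (vertex D (opposite zero))) D ∘ reflection⇒reverse C dc D ∘ proj₂
             ]′ (reindexed D)) , C , dc)
      where
      reachBy : ∀ p (D : Cycle G n) → vertex (shiftOrReverse C dc p) ≗ vertex D →
                ∃[ i ] vertex (shiftsAndReverses C dc i) ≗ vertex D
      reachBy (b , c) D eq = combine b c , λ i →
        trans (cong (λ p → vertex (shiftOrReverse C dc p) i) (remQuot-combine b c)) (eq i)

  -- In exponents: ω^a is a zero of the Hamiltonian ideal iff every i has an
  -- out-neighbour j with a j = a i + 1.
  Tour : (Fin n → Fin n) → Set
  Tour a = ∀ i → ∃[ j ] Arc i j × a j ≡ next (a i)

  label-tour : ∀ C → Tour (label C)
  label-tour C i = vertex C (next (label C i)) ,
    subst (λ v → Arc v (vertex C (next (label C i)))) (vertex-label C i) (arcs C (label C i)) ,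
    label-vertex C _

  -- For a rotation the required out-neighbour is the next vertex of `C`; for a reflection it is the
  -- previous one, reached by a reversed arc.
  symmetry-tour : ∀ C {a} → Symmetry C (a ∘ vertex C) → Tour a
  symmetry-tour C {a} symm i = subst (λ v → ∃[ j ] Arc v j × a j ≡ next (a v)) (vertex-label C i)
    (successor symm (label C i))
    where
    successor : Symmetry C (a ∘ vertex C) → ∀ k → ∃[ j ] Arc (vertex C k) j × a j ≡ next (a (vertex C k))
    successor (inj₁ rot)        k = vertex C (next k) , arcs C k , rot k
    successor (inj₂ (dc , ref)) k = vertex C (prev k) ,
      subst (λ l → Arc (vertex C l) (vertex C (prev k))) (next-prev k) (dc (prev k)) ,
      trans (sym (ref (prev k))) (cong (next ∘ a ∘ vertex C) (next-prev k))

  -- Following out-neighbours realises every label, so `a` is onto and therefore bijective; its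
  -- inverse lists the vertices of a cycle.
  tour⇒cycle : 2 < n → ∀ {a} → Tour a → ∃[ D ] label D ≗ a
  tour⇒cycle 2<n {a} tour = D , λ v → begin
    label D v           ≡⟨ cong (label D) (a-injective (sym (a∘at (a v)))) ⟩
    label D (at (a v))  ≡⟨ label-vertex D (a v) ⟩
    a v                 ∎
    where
    open ≡-Reasoning
    a-surjective : ∀ y → ∃[ x ] a x ≡ y
    a-surjective = next-inductionFrom (λ y → ∃[ x ] a x ≡ y)
      (λ { _ (x , refl) → let j , _ , eq = tour x in j , eq }) (a zero) (zero , refl)

    at : Fin n → Fin n
    at = proj₁ ∘ a-surjective

    a∘at : ∀ y → a (at y) ≡ y
    a∘at = proj₂ ∘ a-surjective

    at-injective : Injective _≡_ _≡_ at
    at-injective {i} {j} eq = trans (sym (a∘at i)) (trans (cong a eq) (a∘at j))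

    a-injective : Injective _≡_ _≡_ a
    a-injective {i} {j} eq
      with p , refl ← injective⇒surjective at-injective i
         | q , refl ← injective⇒surjective at-injective j
      = cong at (trans (sym (a∘at p)) (trans eq (a∘at q)))

    D : Cycle G n
    D .vertex   = at
    D .2<k      = 2<n
    D .distinct = at-injective
    -- The out-neighbour supplied by the tour has label k + 1, so it is `at (next k)`.
    D .arcs k with j , arc , eq ← tour (at k) =
      subst (Arc (at k)) (a-injective (trans eq (trans (cong next (a∘at k)) (sym (a∘at (next k)))))) arc

  unique⇒symmetry : ∀ C → Unique C → ∀ a → Tour a → Symmetry C (a ∘ vertex C)
  unique⇒symmetry C unique a tour =
    let D , eq = tour⇒cycle (2<k C) {a} tour
    in  ⊎-map (rotation-resp-≗ {f = label D ∘ vertex C} {a ∘ vertex C} (eq ∘ vertex C))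
              (map₂ (reflection-resp-≗ {f = label D ∘ vertex C} {a ∘ vertex C} (eq ∘ vertex C)))
              (unique D)

-- Geometric sums and Lagrange projections over a commutative ring.

module RootsOfUnity {c ℓ} (R : CommutativeRing c ℓ) where
  open CommutativeRing R hiding (zero)
  open import Algebra.Properties.CommutativeSemiring.Exp commutativeSemiring
  open import Algebra.Properties.Semiring.Sum semiring
  open import Algebra.Properties.Semiring.Mult semiring using () renaming (_×_ to _·_)
  open import Algebra.Properties.Group +-group using (∙-cancelʳ)
  open import Algebra.Properties.Ring ring using (-‿distribˡ-*)
  open import Algebra.Properties.CommutativeSemigroup *-commutativeSemigroup using (x∙yz≈y∙xz)
  open import Relation.Binary.Reasoning.Setoid setoid

  1^n≈1 : ∀ n → 1# ^ n ≈ 1#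
  1^n≈1 zero    = refl
  1^n≈1 (suc n) = trans (*-identityˡ _) (1^n≈1 n)

  ^-swap : ∀ x m n → (x ^ m) ^ n ≈ (x ^ n) ^ m
  ^-swap x m n = begin
    (x ^ m) ^ n ≈⟨ ^-assocʳ x m n ⟩
    x ^ (m Data.Nat.* n) ≈⟨ ^-congʳ x (Data.Nat.Properties.*-comm m n) ⟩
    x ^ (n Data.Nat.* m) ≈⟨ ^-assocʳ x n m ⟨
    (x ^ n) ^ m ∎
    where import Data.Nat.Properties

  geometric : ℕ → Carrier → Carrier
  geometric n z = ∑[ j < n ] (z ^ toℕ j)

  geometric-suc : ∀ n z → 1# + z * geometric n z ≈ geometric (suc n) z
  geometric-suc n z = +-congˡ (*-distribˡ-sum {n} z (λ j → z ^ toℕ j))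

  -- Both sides are 1 + z + ... + zⁿ, extended at the front and at the back.
  geometric-telescope : ∀ n z → 1# + z * geometric n z ≈ geometric n z + z ^ n
  geometric-telescope zero z = begin
    1# + z * 0# ≈⟨ +-congˡ (zeroʳ z) ⟩
    1# + 0#     ≈⟨ +-comm 1# 0# ⟩
    0# + 1#     ∎
  geometric-telescope (suc n) z = begin
    1# + z * geometric (suc n) z          ≈⟨ +-congˡ (*-congˡ (geometric-suc n z)) ⟨
    1# + z * (1# + z * geometric n z)     ≈⟨ +-congˡ (*-congˡ (geometric-telescope n z)) ⟩
    1# + z * (geometric n z + z ^ n)      ≈⟨ +-congˡ (distribˡ z _ _) ⟩
    1# + (z * geometric n z + z * z ^ n)  ≈⟨ +-assoc _ _ _ ⟨
    1# + z * geometric n z + z ^ suc n    ≈⟨ +-congʳ (geometric-suc n z) ⟩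
    geometric (suc n) z + z ^ suc n       ∎

  geometric-fixed : ∀ n z → z ^ n ≈ 1# → z * geometric n z ≈ geometric n z
  geometric-fixed n z zⁿ≈1 = ∙-cancelʳ 1# _ _ (begin
    z * geometric n z + 1#   ≈⟨ +-comm _ 1# ⟩
    1# + z * geometric n z   ≈⟨ geometric-telescope n z ⟩
    geometric n z + z ^ n    ≈⟨ +-congˡ zⁿ≈1 ⟩
    geometric n z + 1#       ∎)

  -- (z - 1) g = 0 by `geometric-fixed`. The ring may have zero divisors, so z ≠ 1 is replaced by an
  -- explicit inverse `u` of z - 1.
  geometric-vanishes : ∀ n {z u} → z ^ n ≈ 1# → u * (z - 1#) ≈ 1# → geometric n z ≈ 0#
  geometric-vanishes n {z} {u} zⁿ≈1 inv = begin
    g                    ≈⟨ *-identityˡ g ⟨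
    1# * g               ≈⟨ *-congʳ inv ⟨
    u * (z - 1#) * g     ≈⟨ *-assoc u _ g ⟩
    u * ((z - 1#) * g)   ≈⟨ *-congˡ (distribʳ g z (- 1#)) ⟩
    u * (z * g + - 1# * g) ≈⟨ *-congˡ (+-cong (geometric-fixed n z zⁿ≈1)
                                (trans (sym (-‿distribˡ-* 1# g)) (-‿cong (*-identityˡ g)))) ⟩
    u * (g - g)          ≈⟨ *-congˡ (-‿inverseʳ g) ⟩
    u * 0#               ≈⟨ zeroʳ u ⟩
    0#                   ∎
    where g = geometric n z

  geometric-one : ∀ n → geometric n 1# ≈ n · 1#
  geometric-one n = trans (sum-cong-≋ {n} (1^n≈1 ∘ toℕ)) (sum-replicate n)

  module Projections (m : ℕ) {ω θ ν : Carrier}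
    (ωθ≈1 : ω * θ ≈ 1#) (θⁿ≈1 : θ ^ suc m ≈ 1#) (νn≈1 : ν * (suc m · 1#) ≈ 1#)
    (separated : ∀ (j : Fin m) → ∃[ u ] u * (θ ^ toℕ (suc j) - 1#) ≈ 1#) where

    private
      n : ℕ
      n = suc m

    -- The Lagrange idempotent at ω ^ k of the equation x ^ n = 1.
    projection : ℕ → Carrier → Carrier
    projection k x = ν * geometric n (θ ^ k * x)

    θ^k^n≈1 : ∀ k → (θ ^ k) ^ n ≈ 1#
    θ^k^n≈1 k = trans (^-swap θ k n) (trans (^-congˡ k θⁿ≈1) (1^n≈1 k))

    -- Write x = ω^k (θ^k x); the geometric sum absorbs its own base θ^k x, an n-th root of unity.
    projection-eigen : ∀ k {x} → x ^ n ≈ 1# → x * projection k x ≈ ω ^ k * projection k x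
    projection-eigen k {x} xⁿ≈1 = begin
      x * (ν * g)                     ≈⟨ x∙yz≈y∙xz x ν g ⟩
      ν * (x * g)                     ≈⟨ *-congˡ (*-congʳ (*-identityˡ x)) ⟨
      ν * (1# * x * g)                ≈⟨ *-congˡ (*-congʳ (*-congʳ ω^kθ^k≈1)) ⟨
      ν * (ω ^ k * θ ^ k * x * g)     ≈⟨ *-congˡ (*-congʳ (*-assoc _ _ _)) ⟩
      ν * (ω ^ k * (θ ^ k * x) * g)   ≈⟨ *-congˡ (*-assoc _ _ _) ⟩
      ν * (ω ^ k * (θ ^ k * x * g))   ≈⟨ *-congˡ (*-congˡ (geometric-fixed n (θ ^ k * x) fixed)) ⟩
      ν * (ω ^ k * g)                 ≈⟨ x∙yz≈y∙xz ν _ g ⟩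
      ω ^ k * (ν * g)                 ∎
      where
      g = geometric n (θ ^ k * x)
      ω^kθ^k≈1 : ω ^ k * θ ^ k ≈ 1#
      ω^kθ^k≈1 = trans (sym (^-distrib-* ω θ k)) (trans (^-congˡ k ωθ≈1) (1^n≈1 k))
      fixed : (θ ^ k * x) ^ n ≈ 1#
      fixed = begin
        (θ ^ k * x) ^ n      ≈⟨ ^-distrib-* (θ ^ k) x n ⟩
        (θ ^ k) ^ n * x ^ n  ≈⟨ *-cong (θ^k^n≈1 k) xⁿ≈1 ⟩
        1# * 1#              ≈⟨ *-identityˡ 1# ⟩
        1#                   ∎

    -- Orthogonality of characters: after exchanging the sums, x^j has the coefficient ν Σₖ (θ^j)^k,
    -- which is 1 for j = 0 and 0 otherwise.
    ∑-projection : ∀ x → ∑[ k < n ] (projection (toℕ k) x) ≈ 1#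
    ∑-projection x = begin
      ∑[ k < n ] (ν * geometric n (θ ^ toℕ k * x))
        ≈⟨ *-distribˡ-sum {n} ν (λ k → geometric n (θ ^ toℕ k * x)) ⟨
      ν * (∑[ k < n ] ∑[ j < n ] ((θ ^ toℕ k * x) ^ toℕ j))
        ≈⟨ *-congˡ (sum-cong-≋ {n} λ k → sum-cong-≋ {n} λ j →
             trans (^-distrib-* (θ ^ toℕ k) x (toℕ j)) (*-congʳ (^-swap θ (toℕ k) (toℕ j)))) ⟩
      ν * (∑[ k < n ] ∑[ j < n ] ((θ ^ toℕ j) ^ toℕ k * x ^ toℕ j))
        ≈⟨ *-congˡ (∑-comm {n} {n} λ k j → (θ ^ toℕ j) ^ toℕ k * x ^ toℕ j) ⟩
      ν * (∑[ j < n ] ∑[ k < n ] ((θ ^ toℕ j) ^ toℕ k * x ^ toℕ j))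
        ≈⟨ *-congˡ (sum-cong-≋ {n} λ j → *-distribʳ-sum {n} (x ^ toℕ j) λ k → (θ ^ toℕ j) ^ toℕ k) ⟨
      ν * (∑[ j < n ] (geometric n (θ ^ toℕ j) * x ^ toℕ j))
        ≈⟨ *-congˡ (+-cong (trans (*-identityʳ _) (geometric-one n)) vanishing) ⟩
      ν * (n · 1# + 0#)
        ≈⟨ *-congˡ (+-identityʳ _) ⟩
      ν * (n · 1#)
        ≈⟨ νn≈1 ⟩
      1# ∎
      where
      vanishing : ∑[ j < m ] (geometric n (θ ^ suc (toℕ j)) * x ^ suc (toℕ j)) ≈ 0#
      vanishing = trans (sum-cong-≋ {m} λ j → trans
        (*-congʳ (geometric-vanishes n (θ^k^n≈1 (suc (toℕ j))) (proj₂ (separated j)))) (zeroˡ _))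
        (sum-replicate-zero m)

    sieve : ∀ x f → (∀ (k : Fin n) → f * projection (toℕ k) x ≈ 0#) → f ≈ 0#
    sieve x f killed = begin
      f                                       ≈⟨ *-identityʳ f ⟨
      f * 1#                                  ≈⟨ *-congˡ (∑-projection x) ⟨
      f * (∑[ k < n ] (projection (toℕ k) x))   ≈⟨ *-distribˡ-sum {n} f (λ k → projection (toℕ k) x) ⟩
      ∑[ k < n ] (f * projection (toℕ k) x)     ≈⟨ sum-cong-≋ {n} killed ⟩
      ∑[ k < n ] 0#                           ≈⟨ sum-replicate-zero n ⟩
      0#                                      ∎

    -- Plays the indicator function of the point (ω^(a i)) among all tuples of n-th roots of unity.
    gridIdempotent : ∀ {l} → (Fin l → Carrier) → (Fin l → Fin n) → Carrier
    gridIdempotent {zero}  x a = 1#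
    gridIdempotent {suc l} x a =
      projection (toℕ (a zero)) (x zero) * gridIdempotent (x ∘ suc) (a ∘ suc)

    gridIdempotent-eigen : ∀ {l} (x : Fin l → Carrier) → (∀ i → x i ^ n ≈ 1#) → ∀ a i →
      x i * gridIdempotent x a ≈ ω ^ toℕ (a i) * gridIdempotent x a
    gridIdempotent-eigen x xⁿ≈1 a zero = begin
      x zero * (p * e)   ≈⟨ *-assoc _ _ _ ⟨
      x zero * p * e     ≈⟨ *-congʳ (projection-eigen (toℕ (a zero)) (xⁿ≈1 zero)) ⟩
      _ * p * e          ≈⟨ *-assoc _ _ _ ⟩
      _ * (p * e)        ∎
      where
      p = projection (toℕ (a zero)) (x zero)
      e = gridIdempotent (x ∘ suc) (a ∘ suc)
    gridIdempotent-eigen x xⁿ≈1 a (suc i) = begin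
      x (suc i) * (p * e)   ≈⟨ x∙yz≈y∙xz _ p e ⟩
      p * (x (suc i) * e)   ≈⟨ *-congˡ (gridIdempotent-eigen (x ∘ suc) (xⁿ≈1 ∘ suc) (a ∘ suc) i) ⟩
      p * (_ * e)           ≈⟨ x∙yz≈y∙xz p _ e ⟩
      _ * (p * e)           ∎
      where
      p = projection (toℕ (a zero)) (x zero)
      e = gridIdempotent (x ∘ suc) (a ∘ suc)

    -- Induction on the coordinates: for each choice of the later ones, `sieve` removes the
    -- projection of the first.
    gridSieve : ∀ {l} (x : Fin l → Carrier) f →
                (∀ a → f * gridIdempotent x a ≈ 0#) → f ≈ 0#
    gridSieve {zero}  x f killed = trans (sym (*-identityʳ f)) (killed λ ())
    gridSieve {suc l} x f killed = gridSieve (x ∘ suc) f λ a →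
      sieve (x zero) (f * gridIdempotent (x ∘ suc) a) λ k →
        trans (*-assoc f _ _) (trans (*-congˡ (*-comm _ _)) (killed (k ▹ a)))

-- The quotient of a commutative ring by a finitely generated ideal.

module Quotient {c ℓ} (R : CommutativeRing c ℓ) (gs : List (CommutativeRing.Carrier R)) where
  open CommutativeRing R hiding (zero)
  open import Algebra.Properties.Ring ring using (-1*x≈-x; -‿+-comm; -‿distribʳ-*)
  open import Algebra.Properties.AbelianGroup +-abelianGroup using (⁻¹-anti-homo‿-)
  open import Algebra.Properties.CommutativeSemigroup +-commutativeSemigroup using (interchange)
  open import Relation.Binary.Reasoning.Setoid setoid

  private
    I : Pred Carrier (c ⊔ ℓ)
    I = ⟨_⟩ R gs

  infix 4 _∼_
  _∼_ : Carrier → Carrier → Set (c ⊔ ℓ)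
  f ∼ g = I (f - g)

  ≈⇒∼ : ∀ {f g} → f ≈ g → f ∼ g
  ≈⇒∼ {f} {g} f≈g = respects (sym (trans (+-congʳ f≈g) (-‿inverseʳ g))) zero

  private
    negate : ∀ {f} → I f → I (- f)
    negate {f} f∈I = respects (-1*x≈-x f) (multiply (- 1#) f∈I)

    ∼-sym : ∀ {f g} → f ∼ g → g ∼ f
    ∼-sym {f} {g} p = respects (⁻¹-anti-homo‿- f g) (negate p)

    ∼-trans : ∀ {f g h} → f ∼ g → g ∼ h → f ∼ h
    ∼-trans {f} {g} {h} p q = respects (begin
      (f - g) + (g - h)    ≈⟨ +-assoc _ _ _ ⟩
      f + (- g + (g - h))  ≈⟨ +-congˡ (+-assoc _ _ _) ⟨
      f + (- g + g - h)    ≈⟨ +-congˡ (+-congʳ (-‿inverseˡ g)) ⟩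
      f + (0# - h)         ≈⟨ +-congˡ (+-identityˡ _) ⟩
      f - h                ∎) (add p q)

    +-cong-∼ : ∀ {f f′ g g′} → f ∼ f′ → g ∼ g′ → f + g ∼ f′ + g′
    +-cong-∼ {f} {f′} {g} {g′} p q = respects (begin
      (f - f′) + (g - g′)     ≈⟨ interchange _ _ _ _ ⟩
      (f + g) + (- f′ + - g′) ≈⟨ +-congˡ (-‿+-comm f′ g′) ⟩
      (f + g) - (f′ + g′)     ∎) (add p q)

    *-congˡ-∼ : ∀ {f g g′} → g ∼ g′ → f * g ∼ f * g′
    *-congˡ-∼ {f} {g} {g′} q = respects (begin
      f * (g - g′)       ≈⟨ distribˡ f g (- g′) ⟩
      f * g + f * - g′   ≈⟨ +-congˡ (-‿distribʳ-* f g′) ⟨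
      f * g - f * g′     ∎) (multiply f q)

    *-cong-∼ : ∀ {f f′ g g′} → f ∼ f′ → g ∼ g′ → f * g ∼ f′ * g′
    *-cong-∼ p q = ∼-trans (*-congˡ-∼ q)
      (∼-trans (≈⇒∼ (*-comm _ _)) (∼-trans (*-congˡ-∼ p) (≈⇒∼ (*-comm _ _))))

    -‿cong-∼ : ∀ {f g} → f ∼ g → - f ∼ - g
    -‿cong-∼ {f} {g} p = respects (sym (-‿+-comm f (- g))) (negate p)

  -- The carrier stays the same and only the equality is coarsened, so one polynomial expression can
  -- be read in both rings.
  quotientRing : CommutativeRing c (c ⊔ ℓ)
  quotientRing = record
    { isCommutativeRing = record
      { isRing = record
        { +-isAbelianGroup = record
          { isGroup = record
            { isMonoid = record
              { isSemigroup = record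
                { isMagma = record
                  { isEquivalence = record { refl = ≈⇒∼ refl ; sym = ∼-sym ; trans = ∼-trans }
                  ; ∙-cong = +-cong-∼
                  }
                ; assoc = λ f g h → ≈⇒∼ (+-assoc f g h)
                }
              ; identity = ≈⇒∼ ∘ +-identityˡ , ≈⇒∼ ∘ +-identityʳ
              }
            ; inverse = ≈⇒∼ ∘ -‿inverseˡ , ≈⇒∼ ∘ -‿inverseʳ
            ; ⁻¹-cong = -‿cong-∼
            }
          ; comm = λ f g → ≈⇒∼ (+-comm f g)
          }
        ; *-cong = *-cong-∼
        ; *-assoc = λ f g h → ≈⇒∼ (*-assoc f g h)
        ; *-identity = ≈⇒∼ ∘ *-identityˡ , ≈⇒∼ ∘ *-identityʳ
        ; distrib = (λ f g h → ≈⇒∼ (distribˡ f g h)) , (λ f g h → ≈⇒∼ (distribʳ f g h))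
        }
      ; *-comm = λ f g → ≈⇒∼ (*-comm f g)
      }
    }

  -0≈0 : - 0# ≈ 0#
  -0≈0 = trans (sym (+-identityˡ _)) (-‿inverseʳ 0#)

  ∼0⇒∈ : ∀ {f} → f ∼ 0# → I f
  ∼0⇒∈ {f} = respects (trans (+-congˡ -0≈0) (+-identityʳ f))

  ∈⇒∼0 : ∀ {f} → I f → f ∼ 0#
  ∈⇒∼0 {f} = respects (sym (trans (+-congˡ -0≈0) (+-identityʳ f)))

  -- Powers and multiples in the two rings are convertible only at numerals,
  -- the recursion being parametrised by the whole raw bundle.
  private
    module Raw = Algebra.Definitions.RawSemiring (Semiring.rawSemiring semiring)
    module Raw/ = Algebra.Definitions.RawSemiring (Semiring.rawSemiring (CommutativeRing.semiring quotientRing))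

  ^-quotient : ∀ f k → f Raw/.^ k ≡ f Raw.^ k
  ^-quotient f zero    = ≡.refl
  ^-quotient f (suc k) = ≡.cong (f *_) (^-quotient f k)

  ·-quotient : ∀ k f → k Raw/.× f ≡ k Raw.× f
  ·-quotient zero    f = ≡.refl
  ·-quotient (suc k) f = ≡.cong (λ g → f + g) (·-quotient k f)

-- Fields without decidable equality, and the invertibility of n.

module FieldProperties {c ℓ} (K : Field c ℓ) where
  open Field K hiding (zero)
  open import Algebra.Properties.Group +-group using (x∙y⁻¹≈ε⇒x≈y)
  open import Algebra.Properties.Semiring.Mult semiring using (×-homo-+; ×1-homo-*)
  open import Relation.Binary.Reasoning.Setoid setoid

  inverseˡ : ∀ {x} → ¬ x ≈ 0# → x ⁻¹ * x ≈ 1#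
  inverseˡ x≉0 = trans (*-comm _ _) (inverseʳ x≉0)

  x*y≈0⇒y≈0 : ∀ {x y} → ¬ x ≈ 0# → x * y ≈ 0# → y ≈ 0#
  x*y≈0⇒y≈0 {x} {y} x≉0 xy≈0 = begin
    y               ≈⟨ *-identityˡ y ⟨
    1# * y          ≈⟨ *-congʳ (inverseˡ x≉0) ⟨
    x ⁻¹ * x * y    ≈⟨ *-assoc _ x y ⟩
    x ⁻¹ * (x * y)  ≈⟨ *-congˡ xy≈0 ⟩
    x ⁻¹ * 0#       ≈⟨ zeroʳ _ ⟩
    0#              ∎

  *-nonzero : ∀ {x y} → ¬ x ≈ 0# → ¬ y ≈ 0# → ¬ x * y ≈ 0#
  *-nonzero x≉0 y≉0 = y≉0 ∘ x*y≈0⇒y≈0 x≉0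

  x≉y⇒x-y≉0 : ∀ {x y} → ¬ x ≈ y → ¬ x - y ≈ 0#
  x≉y⇒x-y≉0 x≉y = x≉y ∘ x∙y⁻¹≈ε⇒x≈y _ _

  -- The least k > 0 with k · 1 ≈ 0 is the characteristic; having no
  -- decidable equality, we only refute its existence.
  n·1≉0 : ∀ {n} → 0 < n → (∀ p → HasCharacteristic K p → p ≡ 0 ⊎ Coprime p n) → ¬ n · 1# ≈ 0#
  n·1≉0 {n} 0<n coprime n·1≈0 = <-rec (λ k → 0 < k → ¬ k · 1# ≈ 0#) refute n 0<n n·1≈0
    where
    refute : ∀ k → (∀ {l} → l < k → 0 < l → ¬ l · 1# ≈ 0#) → 0 < k → ¬ k · 1# ≈ 0#
    refute k@(suc _) minimal 0<k k·1≈0 = [ (λ ()) , impossible ]′ (coprime k characteristic)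
      where
      multiples : ∀ q → (q ℕ.* k) · 1# ≈ 0#
      multiples q = trans (×1-homo-* q k) (trans (*-congˡ k·1≈0) (zeroʳ _))

      -- The remainder of `l` modulo `k` also annihilates 1, so by minimality of `k` it is zero.
      divisible : ∀ l → l · 1# ≈ 0# → k ∣ l
      divisible l l·1≈0 with l % k in eq
      ... | zero  = m%n≡0⇒n∣m l k eq
      ... | suc r = contradiction (begin
        suc r · 1#                            ≡⟨ cong (_· 1#) eq ⟨
        (l % k) · 1#                          ≈⟨ +-identityʳ _ ⟨
        (l % k) · 1# + 0#                     ≈⟨ +-congˡ (multiples (l ℕ./ k)) ⟨
        (l % k) · 1# + (l ℕ./ k ℕ.* k) · 1#   ≈⟨ ×-homo-+ 1# (l % k) _ ⟨
        (l % k ℕ.+ l ℕ./ k ℕ.* k) · 1#        ≡⟨ cong (_· 1#) (m≡m%n+[m/n]*n l k) ⟨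
        l · 1#                                ≈⟨ l·1≈0 ⟩
        0#                                    ∎) (minimal (subst (_< k) eq (m%n<n l k)) z<s)

      characteristic : HasCharacteristic K k
      characteristic l = mk⇔ (divisible l) λ { (divides-refl q) → multiples q }

      -- `k` divides n because n · 1 ≈ 0; coprimality then leaves k = 1, that is 1 ≈ 0.
      impossible : ¬ Coprime k n
      impossible k⊥n = 1≉0 (trans (sym (+-identityʳ 1#))
        (subst (λ p → p · 1# ≈ 0#) (k⊥n (∣-refl , divisible n n·1≈0)) k·1≈0))


-- Powers of ω, cyclic progressions, and the coefficients of the doubly covered case.

module Roots {c ℓ} (K : Field c ℓ) (m : ℕ) (ω : Field.Carrier K)
  (isPrimitive : PrimitiveRoot K (suc m) ω) where
  open Field K hiding (zero)
  open FieldProperties K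
  open RootsOfUnity commutativeRing using (1^n≈1; ^-swap)
  open import Algebra.Properties.CommutativeSemiring.Exp commutativeSemiring hiding (_^_)
  open import Algebra.Properties.CommutativeSemigroup *-commutativeSemigroup using (interchange)
  open import Algebra.Properties.Group +-group using (x∙y⁻¹≈ε⇒x≈y)
  open import Algebra.Properties.Ring ring using (-‿distribʳ-*; -‿+-comm)
  open import Algebra.Solver.Ring.NaturalCoefficients.Default commutativeSemiring
    using (solve; _:=_; _:+_; _:*_; con)
  open import Relation.Binary.Reasoning.Setoid setoid

  private
    n : ℕ
    n = suc m

    ωⁿ≈1 : ω ^ n ≈ 1#
    ωⁿ≈1 = proj₁ isPrimitive

  θ : Carrier
  θ = ω ⁻¹

  ω≉0 : ¬ ω ≈ 0#
  ω≉0 ω≈0 = 1≉0 (trans (sym ωⁿ≈1) (trans (*-congʳ ω≈0) (zeroˡ _)))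

  ωθ≈1 : ω * θ ≈ 1#
  ωθ≈1 = inverseʳ ω≉0

  θω≈1 : θ * ω ≈ 1#
  θω≈1 = inverseˡ ω≉0

  ωθ-cancel : ∀ x → ω * (θ * x) ≈ x
  ωθ-cancel x = trans (sym (*-assoc ω θ x)) (trans (*-congʳ ωθ≈1) (*-identityˡ x))

  θω-cancel : ∀ x → θ * (ω * x) ≈ x
  θω-cancel x = trans (sym (*-assoc θ ω x)) (trans (*-congʳ θω≈1) (*-identityˡ x))

  ω^kθ^k≈1 : ∀ k → ω ^ k * θ ^ k ≈ 1#
  ω^kθ^k≈1 k = trans (sym (^-distrib-* ω θ k)) (trans (^-congˡ k ωθ≈1) (1^n≈1 k))

  θⁿ≈1 : θ ^ n ≈ 1#
  θⁿ≈1 = trans (sym (*-identityˡ _)) (trans (*-congʳ (sym ωⁿ≈1)) (ω^kθ^k≈1 n))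

  θ^k≉1 : ∀ {k} → 0 < k → k < n → ¬ θ ^ k ≈ 1#
  θ^k≉1 {k} 0<k k<n θ^k≈1 = proj₂ isPrimitive k 0<k k<n
    (trans (sym (*-identityʳ _)) (trans (*-congˡ (sym θ^k≈1)) (ω^kθ^k≈1 k)))

  pow : Fin n → Carrier
  pow i = ω ^ toℕ i

  pow-suc : ∀ i → pow (next i) ≈ ω * pow i
  pow-suc i with view i
  ... | ‵fromℕ     = begin
    pow (next (fromℕ m))   ≡⟨ cong pow (next-fromℕ m) ⟩
    1#                     ≈⟨ ωⁿ≈1 ⟨
    ω * ω ^ m              ≡⟨ cong (λ k → ω * ω ^ k) (toℕ-fromℕ m) ⟨
    ω * pow (fromℕ m)      ∎
  ... | ‵inject₁ j = begin
    pow (next (inject₁ j)) ≡⟨ cong pow (next-inject₁ j) ⟩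
    ω * ω ^ toℕ j          ≡⟨ cong (λ k → ω * ω ^ k) (toℕ-inject₁ j) ⟨
    ω * pow (inject₁ j)    ∎

  -- Multiplying by θ^k would give ω^(l - k) ≈ 1 with 0 < l - k < n.
  ω^-distinct : ∀ {k l} → k < l → l < n → ¬ ω ^ k ≈ ω ^ l
  ω^-distinct {k} {l} k<l l<n eq =
    proj₂ isPrimitive (l ∸ k) (ℕ.m<n⇒0<n∸m k<l) (ℕ.≤-<-trans (ℕ.m∸n≤m l k) l<n) (begin
      ω ^ (l ∸ k)                       ≈⟨ *-identityˡ _ ⟨
      1# * ω ^ (l ∸ k)                  ≈⟨ *-congʳ (ω^kθ^k≈1 k) ⟨
      ω ^ k * θ ^ k * ω ^ (l ∸ k)       ≈⟨ *-congʳ (*-comm _ _) ⟩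
      θ ^ k * ω ^ k * ω ^ (l ∸ k)       ≈⟨ *-assoc _ _ _ ⟩
      θ ^ k * (ω ^ k * ω ^ (l ∸ k))     ≈⟨ *-congˡ (^-homo-* ω k (l ∸ k)) ⟨
      θ ^ k * ω ^ (k ℕ.+ (l ∸ k))       ≡⟨ cong (λ e → θ ^ k * ω ^ e) (ℕ.m+[n∸m]≡n (ℕ.<⇒≤ k<l)) ⟩
      θ ^ k * ω ^ l                     ≈⟨ *-congˡ eq ⟨
      θ ^ k * ω ^ k                     ≈⟨ *-comm _ _ ⟩
      ω ^ k * θ ^ k                     ≈⟨ ω^kθ^k≈1 k ⟩
      1#                                ∎)

  -- The bridge from equality in `K` back to labels: the case distinction is made on exponents,
  -- whose order is decidable.
  pow-injective : ∀ {i j} → pow i ≈ pow j → i ≡ j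
  pow-injective {i} {j} eq with ℕ.<-cmp (toℕ i) (toℕ j)
  ... | tri< i<j _ _ = contradiction eq (ω^-distinct i<j (toℕ<n j))
  ... | tri≈ _ i≡j _ = toℕ-injective i≡j
  ... | tri> _ _ j<i = contradiction (sym eq) (ω^-distinct j<i (toℕ<n i))

  pow^n≈1 : ∀ i → pow i ^ n ≈ 1#
  pow^n≈1 i = trans (^-swap ω (toℕ i) n) (trans (^-congˡ (toℕ i) ωⁿ≈1) (1^n≈1 (toℕ i)))

  θ^-separated : ∀ (j : Fin m) → ∃[ u ] u * (θ ^ toℕ (suc j) - 1#) ≈ 1#
  θ^-separated j = _ , inverseˡ (x≉y⇒x-y≉0 (θ^k≉1 z<s (s<s (toℕ<n j))))

  -- The step from the last index to the first is included, which for βⁿ = 1 amounts to qᵢ = β^(i+1)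
  -- q_last, counting from 0: the shape of the generators.
  Progression : Carrier → (Fin n → Carrier) → Set ℓ
  Progression β q = ∀ i → q (next i) ≈ β * q i

  module _ {β : Carrier} (βⁿ≈1 : β ^ n ≈ 1#) {q : Fin n → Carrier} where

    progression⇒fromLast : Progression β q → ∀ i → q i ≈ β ^ suc (toℕ i) * q (fromℕ m)
    progression⇒fromLast prog = <-weakInduction _ first later
      where
      first : q zero ≈ β ^ 1 * q (fromℕ m)
      first = begin
        q zero                 ≡⟨ cong q (next-fromℕ m) ⟨
        q (next (fromℕ m))     ≈⟨ prog (fromℕ m) ⟩
        β * q (fromℕ m)        ≈⟨ *-congʳ (*-identityʳ β) ⟨
        β ^ 1 * q (fromℕ m)    ∎
      later : ∀ i → q (inject₁ i) ≈ β ^ suc (toℕ (inject₁ i)) * q (fromℕ m) →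
             q (suc i) ≈ β ^ suc (suc (toℕ i)) * q (fromℕ m)
      later i eq = begin
        q (suc i)                                        ≡⟨ cong q (next-inject₁ i) ⟨
        q (next (inject₁ i))                             ≈⟨ prog (inject₁ i) ⟩
        β * q (inject₁ i)                                ≈⟨ *-congˡ eq ⟩
        β * (β ^ suc (toℕ (inject₁ i)) * q (fromℕ m))    ≡⟨ cong (λ k → β * (β ^ suc k * q (fromℕ m))) (toℕ-inject₁ i) ⟩
        β * (β ^ suc (toℕ i) * q (fromℕ m))              ≈⟨ *-assoc _ _ _ ⟨
        β ^ suc (suc (toℕ i)) * q (fromℕ m)              ∎

    -- The equation missing from the hypothesis, at the last index itself, is βⁿ ≈ 1.
    fromLast⇒progression : (∀ (i : Fin m) → q (inject₁ i) ≈ β ^ suc (toℕ i) * q (fromℕ m)) →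
                           Progression β q
    fromLast⇒progression eqs = prog
      where
      eqs′ : ∀ i → q i ≈ β ^ suc (toℕ i) * q (fromℕ m)
      eqs′ i with view i
      ... | ‵fromℕ = sym (begin
        β ^ suc (toℕ (fromℕ m)) * q (fromℕ m) ≡⟨ cong (λ k → β ^ suc k * q (fromℕ m)) (toℕ-fromℕ m) ⟩
        β ^ n * q (fromℕ m)                   ≈⟨ *-congʳ βⁿ≈1 ⟩
        1# * q (fromℕ m)                      ≈⟨ *-identityˡ _ ⟩
        q (fromℕ m)                           ∎)
      ... | ‵inject₁ j = trans (eqs j) (reflexive (cong (λ k → β ^ suc k * q (fromℕ m)) (≡.sym (toℕ-inject₁ j))))

      prog : Progression β q
      prog i with view i
      ... | ‵fromℕ = begin
        q (next (fromℕ m))     ≡⟨ cong q (next-fromℕ m) ⟩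
        q zero                 ≈⟨ eqs′ zero ⟩
        β ^ 1 * q (fromℕ m)    ≈⟨ *-congʳ (*-identityʳ β) ⟩
        β * q (fromℕ m)        ∎
      ... | ‵inject₁ j = begin
        q (next (inject₁ j))                   ≡⟨ cong q (next-inject₁ j) ⟩
        q (suc j)                              ≈⟨ eqs′ (suc j) ⟩
        β ^ suc (suc (toℕ j)) * q (fromℕ m)    ≈⟨ *-assoc _ _ _ ⟩
        β * (β ^ suc (toℕ j) * q (fromℕ m))    ≈⟨ *-congˡ (eqs j) ⟨
        β * q (inject₁ j)                      ∎

  module _ {b : Fin n → Fin n} where

    rotation⇒progression : Rotation b → Progression ω (pow ∘ b)
    rotation⇒progression rot i = trans (reflexive (cong pow (rot i))) (pow-suc (b i))

    progression⇒rotation : Progression ω (pow ∘ b) → Rotation b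
    progression⇒rotation prog i = pow-injective (trans (prog i) (sym (pow-suc (b i))))

    reflection⇒progression : Reflection b → Progression θ (pow ∘ b)
    reflection⇒progression ref i = begin
      pow (b (next i))               ≈⟨ θω-cancel _ ⟨
      θ * (ω * pow (b (next i)))     ≈⟨ *-congˡ (pow-suc (b (next i))) ⟨
      θ * pow (next (b (next i)))    ≡⟨ cong (λ j → θ * pow j) (ref i) ⟩
      θ * pow (b i)                  ∎

    progression⇒reflection : Progression θ (pow ∘ b) → Reflection b
    progression⇒reflection prog i = pow-injective (begin
      pow (next (b (next i)))        ≈⟨ pow-suc (b (next i)) ⟩
      ω * pow (b (next i))           ≈⟨ *-congˡ (prog i) ⟩
      ω * (θ * pow (b i))            ≈⟨ ωθ-cancel _ ⟩
      pow (b i)                      ∎)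

  ω^ℤ-⊖ : ∀ k l → ω ^ℤ (k ⊖ l) ≈ ω ^ k * θ ^ l
  ω^ℤ-⊖ k       zero    = sym (*-identityʳ _)
  ω^ℤ-⊖ zero    (suc l) = sym (*-identityˡ _)
  ω^ℤ-⊖ (suc k) (suc l) = begin
    ω ^ℤ (suc k ⊖ suc l)          ≡⟨ cong (ω ^ℤ_) (ℤ.[1+m]⊖[1+n]≡m⊖n k l) ⟩
    ω ^ℤ (k ⊖ l)                  ≈⟨ ω^ℤ-⊖ k l ⟩
    ω ^ k * θ ^ l                 ≈⟨ *-identityˡ _ ⟨
    1# * (ω ^ k * θ ^ l)          ≈⟨ *-congʳ ωθ≈1 ⟨
    ω * θ * (ω ^ k * θ ^ l)       ≈⟨ interchange ω θ _ _ ⟩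
    ω ^ suc k * θ ^ suc l         ∎

  -- The identity behind the linear generators of a doubly covered cycle:
  -- x_{v_i} is the combination of x_{v_{k-1}} and x_{v_k} with coefficients
  -- −A and −B both for β = ω and for β = ω⁻¹.
  module _ (2<n : 2 < n) (i : ℕ) where

    -- With [r] = (ω^r - ω^(-r)) / (ω - ω⁻¹), cancelling ω² gives A = [r] and B = -[r + 1] for r =
    -- `suc i`. The relation is β^r = [r + 1] - [r] β⁻¹, and [r] is unchanged when ω and ω⁻¹ are
    -- swapped.
    denominator A B : Carrier
    denominator = ω ^ 3 - ω
    A = (ω ^ℤ (+ 2 ℤ.+ + suc i) - ω ^ℤ (+ 2 ℤ.- + suc i)) / denominator
    B = (ω ^ℤ (+ 1 ℤ.- + suc i) - ω ^ℤ (+ 3 ℤ.+ + suc i)) / denominator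

    -- ω³ ≈ ω would give ω² ≈ 1, contrary to primitivity as 2 < n.
    denominator≉0 : ¬ denominator ≈ 0#
    denominator≉0 = x≉y⇒x-y≉0 λ ω³≈ω → proj₂ isPrimitive 2 z<s 2<n
      (x∙y⁻¹≈ε⇒x≈y _ _ (x*y≈0⇒y≈0 ω≉0 (begin
        ω * (ω ^ 2 - 1#)          ≈⟨ distribˡ ω _ _ ⟩
        ω ^ 3 + ω * - 1#          ≈⟨ +-cong ω³≈ω (sym (-‿distribʳ-* ω 1#)) ⟩
        ω - ω * 1#                ≈⟨ +-congˡ (-‿cong (*-identityʳ ω)) ⟩
        ω - ω                     ≈⟨ -‿inverseʳ ω ⟩
        0#                        ∎)))

    private
      W T P Q R S : Carrier
      W = ω ^ suc i
      T = θ ^ suc i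
      P = ω ^ℤ (+ 2 ℤ.+ + suc i)
      Q = ω ^ℤ (+ 2 ℤ.- + suc i)
      R = ω ^ℤ (+ 1 ℤ.- + suc i)
      S = ω ^ℤ (+ 3 ℤ.+ + suc i)

    -- Clears the denominator and moves negative terms across: the hypothesis is free of
    -- subtraction, as the commutative semiring solver requires.
    linearRelation : ∀ X z → X * ω ^ 3 + z * P + R ≈ X * ω + z * Q + S → X + A * z + B ≈ 0#
    linearRelation X z eq = begin
      X + A * z + B
        ≈⟨ +-congʳ (+-congʳ (trans (sym (*-identityʳ X)) (*-congˡ (sym (inverseʳ denominator≉0))))) ⟩
      X * (denominator * denominator ⁻¹) + A * z + B
        ≈⟨ solve 6 (λ X d e a z b → X :* (d :* e) :+ a :* e :* z :+ b :* e := (X :* d :+ a :* z :+ b) :* e)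
             refl X denominator (denominator ⁻¹) (P - Q) z (R - S) ⟩
      (X * (ω ^ 3 - ω) + (P - Q) * z + (R - S)) * denominator ⁻¹
        ≈⟨ *-congʳ (solve 8 (λ X c ω z p q r s → X :* (c :+ ω) :+ (p :+ q) :* z :+ (r :+ s) :=
                                (X :* c :+ z :* p :+ r) :+ (X :* ω :+ z :* q :+ s))
             refl X (ω ^ 3) (- ω) z P (- Q) R (- S)) ⟩
      ((X * ω ^ 3 + z * P + R) + (X * - ω + z * - Q + - S)) * denominator ⁻¹
        ≈⟨ *-congʳ (+-congˡ (+-congʳ (trans
             (+-cong (sym (-‿distribʳ-* X ω)) (sym (-‿distribʳ-* z Q))) (-‿+-comm _ _)))) ⟩
      ((X * ω ^ 3 + z * P + R) + (- (X * ω + z * Q) + - S)) * denominator ⁻¹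
        ≈⟨ *-congʳ (+-cong eq (-‿+-comm _ _)) ⟩
      ((X * ω + z * Q + S) - (X * ω + z * Q + S)) * denominator ⁻¹
        ≈⟨ *-congʳ (-‿inverseʳ _) ⟩
      0# * denominator ⁻¹
        ≈⟨ zeroˡ _ ⟩
      0# ∎

    -- The terms match in pairs: W ω³ = S, θ P = W ω and R = θ Q.
    linearRelation-ω : W + A * θ + B ≈ 0#
    linearRelation-ω = linearRelation W θ (begin
      W * ω ^ 3 + θ * P + R
        ≈⟨ +-congˡ (ω^ℤ-⊖ 1 (suc i)) ⟩
      W * ω ^ 3 + θ * P + ω ^ 1 * T
        ≈⟨ solve 4 (λ ω θ W T → W :* (ω :* (ω :* (ω :* con 1))) :+ θ :* (ω :* (ω :* W)) :+ (ω :* con 1) :* T :=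
                              θ :* (ω :* (ω :* W)) :+ ω :* T :+ ω :* (ω :* (ω :* W))) refl ω θ W T ⟩
      θ * (ω * (ω * W)) + ω * T + S
        ≈⟨ +-congʳ (+-cong (θω-cancel _) (sym (θω-cancel _))) ⟩
      ω * W + θ * (ω * (ω * T)) + S
        ≈⟨ +-congʳ (solve 4 (λ ω θ W T → ω :* W :+ θ :* (ω :* (ω :* T)) :=
             W :* ω :+ θ :* (ω :* (ω :* con 1) :* T)) refl ω θ W T) ⟩
      W * ω + θ * (ω ^ 2 * T) + S
        ≈⟨ +-congʳ (+-congˡ (*-congˡ (ω^ℤ-⊖ 2 (suc i)))) ⟨
      W * ω + θ * Q + S ∎)

    -- Here the pairs are T ω³ = ω Q, ω P = S and R = T ω.
    linearRelation-θ : T + A * ω + B ≈ 0#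
    linearRelation-θ = linearRelation T ω (begin
      T * ω ^ 3 + ω * P + R
        ≈⟨ +-congˡ (ω^ℤ-⊖ 1 (suc i)) ⟩
      T * ω ^ 3 + ω * P + ω ^ 1 * T
        ≈⟨ solve 3 (λ ω W T → T :* (ω :* (ω :* (ω :* con 1))) :+ ω :* (ω :* (ω :* W)) :+ (ω :* con 1) :* T :=
                              T :* ω :+ ω :* (ω :* (ω :* con 1) :* T) :+ ω :* (ω :* (ω :* W))) refl ω W T ⟩
      T * ω + ω * (ω ^ 2 * T) + S
        ≈⟨ +-congʳ (+-congˡ (*-congˡ (ω^ℤ-⊖ 2 (suc i)))) ⟨
      T * ω + ω * Q + S ∎)

-- Evaluation of polynomials at a point.

module Evaluation {c ℓ} (K : Field c ℓ) (n : ℕ) where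
  private module K = Field K
  open Polynomials K n
  open CommutativeRing polynomialRing using (1#; _*_; semiring)
  open import Algebra.Definitions.RawSemiring (Semiring.rawSemiring semiring)
    using (_^_) renaming (_×_ to _·_)

  con-^ : ∀ x k → con (x K.^ k) ≋ con x ^ k
  con-^ x zero    = ≋-refl
  con-^ x (suc k) = ≋-trans (con-* x _) (⊗-cong ≋-refl (con-^ x k))

  con-· : ∀ k → con (k K.· K.1#) ≋ k · 1#
  con-· zero    = ≋-refl
  con-· (suc k) = ≋-trans (con-+ _ _) (⊕-cong ≋-refl (con-· k))

  -- The congruence makes `con` respect sums and products; negation follows by uniqueness of
  -- additive inverses.
  con-⊖ : ∀ x → con (K.- x) ≋ ⊖ con x
  con-⊖ x = inverseˡ-unique (con (K.- x)) (con x)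
    (≋-trans (≋-sym (con-+ _ _)) (con-cong (K.-‿inverseˡ x)))
    where open import Algebra.Properties.Group (CommutativeRing.+-group polynomialRing) using (inverseˡ-unique)

  module _ (a : Fin n → K.Carrier) where

    eval : Poly → K.Carrier
    eval (con x) = x
    eval (var i) = a i
    eval (p ⊕ q) = eval p K.+ eval q
    eval (p ⊗ q) = eval p K.* eval q
    eval (⊖ p)   = K.- eval p

    eval-cong : ∀ {p q} → p ≋ q → eval p K.≈ eval q
    eval-cong ≋-refl             = K.refl
    eval-cong (≋-sym p≋q)        = K.sym (eval-cong p≋q)
    eval-cong (≋-trans p≋q q≋r)  = K.trans (eval-cong p≋q) (eval-cong q≋r)
    eval-cong (con-cong x≈y)     = x≈y
    eval-cong (⊕-cong p≋ q≋)     = K.+-cong (eval-cong p≋) (eval-cong q≋)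
    eval-cong (⊗-cong p≋ q≋)     = K.*-cong (eval-cong p≋) (eval-cong q≋)
    eval-cong (⊖-cong p≋)        = K.-‿cong (eval-cong p≋)
    eval-cong (con-+ _ _)        = K.refl
    eval-cong (con-* _ _)        = K.refl
    eval-cong (⊕-assoc _ _ _)    = K.+-assoc _ _ _
    eval-cong (⊕-comm _ _)       = K.+-comm _ _
    eval-cong (⊕-identityˡ _)    = K.+-identityˡ _
    eval-cong (⊖-inverseˡ _)     = K.-‿inverseˡ _
    eval-cong (⊗-assoc _ _ _)    = K.*-assoc _ _ _
    eval-cong (⊗-comm _ _)       = K.*-comm _ _
    eval-cong (⊗-identityˡ _)    = K.*-identityˡ _
    eval-cong (⊗-distribˡ _ _ _) = K.distribˡ _ _ _

    eval-^ : ∀ p k → eval (p ^ k) ≡ eval p K.^ k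
    eval-^ p zero    = ≡.refl
    eval-^ p (suc k) = cong (eval p K.*_) (eval-^ p k)

    Vanishes : Poly → Set ℓ
    Vanishes f = eval f K.≈ K.0#

    vanishes-⟨⟩ : ∀ {gs} → (∀ {g} → g ∈ gs → Vanishes g) → ∀ {f} → ⟨_⟩ polynomialRing gs f → Vanishes f
    vanishes-⟨⟩ v (generator g∈gs) = v g∈gs
    vanishes-⟨⟩ v zero             = K.refl
    vanishes-⟨⟩ v (add p q)        = K.trans (K.+-cong (vanishes-⟨⟩ v p) (vanishes-⟨⟩ v q)) (K.+-identityˡ _)
    vanishes-⟨⟩ v (multiply f p)   = K.trans (K.*-congˡ (vanishes-⟨⟩ v p)) (K.zeroʳ _)
    vanishes-⟨⟩ v (respects f≈g p) = K.trans (K.sym (eval-cong f≈g)) (vanishes-⟨⟩ v p)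

    vanishes-product : ∀ {A : Set} (f : A → Poly) {js j} → j ∈ js → Vanishes (f j) →
                       Vanishes (foldr _*_ 1# (map f js))
    vanishes-product f (here ≡.refl) v = K.trans (K.*-congʳ v) (K.zeroˡ _)
    vanishes-product f (there j∈js)  v = K.trans (K.*-congˡ (vanishes-product f j∈js v)) (K.zeroʳ _)

    nonvanishing-product : ∀ {A : Set} (f : A → Poly) {js} → (∀ {j} → j ∈ js → ¬ Vanishes (f j)) →
                           ¬ Vanishes (foldr _*_ 1# (map f js))
    nonvanishing-product f {[]}     _ = K.1≉0
    nonvanishing-product f {j ∷ js} v =
      FieldProperties.*-nonzero K (v (here ≡.refl)) (nonvanishing-product f (v ∘ there))

-- Elements of the quotient ring that behave like points.

module Localisation {c ℓ} (K : Field c ℓ) (n : ℕ) (gs : List (Polynomials.Poly K n)) where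
  private module K = Field K
  open Polynomials K n
  open Evaluation K n
  open Quotient polynomialRing gs public
  open CommutativeRing quotientRing public hiding (zero)
  open import Algebra.Definitions.RawSemiring (Semiring.rawSemiring semiring)
    using (_^_) renaming (_×_ to _·_)
  open import Algebra.Properties.Ring ring using (-‿distribˡ-*)
  open import Algebra.Properties.Group +-group using (x∙y⁻¹≈ε⇒x≈y)
  open import Relation.Binary.Reasoning.Setoid setoid

  private
    ≋-reflexive : ∀ {p q} → p ≡ q → p ≋ q
    ≋-reflexive ≡.refl = ≋-refl

  con-cong-∼ : ∀ {x y} → x K.≈ y → con x ≈ con y
  con-cong-∼ = ≈⇒∼ ∘ con-cong

  con-^-∼ : ∀ x k → con (x K.^ k) ≈ con x ^ k
  con-^-∼ x k = ≈⇒∼ (≋-trans (con-^ x k) (≋-reflexive (≡.sym (^-quotient (con x) k))))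

  con-·-∼ : ∀ k → con (k K.· K.1#) ≈ k · con K.1#
  con-·-∼ k = ≈⇒∼ (≋-trans (con-· k) (≋-reflexive (≡.sym (·-quotient k (con K.1#)))))

  eigen⇒killed : ∀ {x c e} → x * e ≈ c * e → (x - c) * e ≈ con K.0#
  eigen⇒killed {x} {c} {e} eq = trans (distribʳ e x (- c))
    (trans (+-cong eq (sym (-‿distribˡ-* c e))) (-‿inverseʳ _))

  killed⇒eigen : ∀ {x c e} → (x - c) * e ≈ con K.0# → x * e ≈ c * e
  killed⇒eigen {x} {c} {e} eq = x∙y⁻¹≈ε⇒x≈y _ _
    (trans (trans (+-congˡ (-‿distribˡ-* c e)) (sym (distribʳ e x (- c)))) eq)

  con-*-assoc : ∀ x y e → con (x K.* y) * e ≈ con x * (con y * e)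
  con-*-assoc x y e = trans (*-congʳ (≈⇒∼ (con-* x y))) (*-assoc _ _ e)

  module _ {a : Fin n → K.Carrier} {e : Poly} (eigen : ∀ i → var i * e ≈ con (a i) * e) where

    -- Induction on `p`: the scalars by which polynomials act on `e` add, multiply and negate as
    -- values at `a` do.
    localise : ∀ p → p * e ≈ con (eval a p) * e
    localise (con x) = refl
    localise (var i) = eigen i
    localise (p ⊕ q) = begin
      (p + q) * e                               ≈⟨ distribʳ e p q ⟩
      p * e + q * e                             ≈⟨ +-cong (localise p) (localise q) ⟩
      con (eval a p) * e + con (eval a q) * e   ≈⟨ distribʳ e _ _ ⟨
      (con (eval a p) + con (eval a q)) * e     ≈⟨ *-congʳ (≈⇒∼ (con-+ _ _)) ⟨
      con (eval a p K.+ eval a q) * e           ∎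
    localise (p ⊗ q) = begin
      p * q * e                                 ≈⟨ *-assoc p q e ⟩
      p * (q * e)                               ≈⟨ *-congˡ (localise q) ⟩
      p * (con (eval a q) * e)                  ≈⟨ x∙yz≈y∙xz p _ e ⟩
      con (eval a q) * (p * e)                  ≈⟨ *-congˡ (localise p) ⟩
      con (eval a q) * (con (eval a p) * e)     ≈⟨ x∙yz≈y∙xz _ _ e ⟩
      con (eval a p) * (con (eval a q) * e)     ≈⟨ con-*-assoc _ _ e ⟨
      con (eval a p K.* eval a q) * e           ∎
      where open import Algebra.Properties.CommutativeSemigroup *-commutativeSemigroup using (x∙yz≈y∙xz)
    localise (⊖ p) = begin
      - p * e                                   ≈⟨ -‿distribˡ-* p e ⟨
      - (p * e)                                 ≈⟨ -‿cong (localise p) ⟩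
      - (con (eval a p) * e)                    ≈⟨ -‿distribˡ-* _ e ⟩
      - con (eval a p) * e                      ≈⟨ *-congʳ (≈⇒∼ (con-⊖ _)) ⟨
      con (K.- eval a p) * e                    ∎

    vanishing⇒killed : ∀ {f} → Vanishes a f → f * e ≈ con K.0#
    vanishing⇒killed {f} v = trans (localise f) (trans (*-congʳ (con-cong-∼ v)) (zeroˡ e))

  con-cancel : ∀ {x e} → ¬ x K.≈ K.0# → con x * e ≈ con K.0# → e ≈ con K.0#
  con-cancel {x} {e} x≉0 xe≈0 = begin
    e                             ≈⟨ *-identityˡ e ⟨
    con K.1# * e                  ≈⟨ *-congʳ (con-cong-∼ (FieldProperties.inverseˡ K x≉0)) ⟨
    con (x K.⁻¹ K.* x) * e        ≈⟨ con-*-assoc _ x e ⟩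
    con (x K.⁻¹) * (con x * e)    ≈⟨ *-congˡ xe≈0 ⟩
    con (x K.⁻¹) * con K.0#       ≈⟨ zeroʳ _ ⟩
    con K.0#                      ∎

-- The Lagrange projections in a quotient of the polynomial ring.

module GridAlgebra {c ℓ} (K : Field c ℓ) (m : ℕ) (ω : Field.Carrier K)
  (isPrimitive : PrimitiveRoot K (suc m) ω)
  (n≉0 : ¬ Field._≈_ K (Field._·_ K (suc m) (Field.1# K)) (Field.0# K))
  (gs : List (Polynomials.Poly K (suc m))) where

  private module K = Field K
  open Roots K m ω isPrimitive
  open Polynomials K (suc m)
  open Evaluation K (suc m)
  open Localisation K (suc m) gs
  open import Algebra.Definitions.RawSemiring (Semiring.rawSemiring semiring)
    using (_^_) renaming (_×_ to _·_)

  private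
    ν : K.Carrier
    ν = (suc m K.· K.1#) K.⁻¹

    con-ωθ≈1 : con ω * con θ ≈ con K.1#
    con-ωθ≈1 = trans (sym (≈⇒∼ (con-* ω θ))) (con-cong-∼ ωθ≈1)

    con-θⁿ≈1 : con θ ^ suc m ≈ con K.1#
    con-θⁿ≈1 = trans (sym (con-^-∼ θ (suc m))) (con-cong-∼ θⁿ≈1)

    con-νn≈1 : con ν * (suc m · con K.1#) ≈ con K.1#
    con-νn≈1 = trans (*-congˡ (sym (con-·-∼ (suc m))))
      (trans (sym (≈⇒∼ (con-* _ _))) (con-cong-∼ (FieldProperties.inverseˡ K n≉0)))

    con-separated : ∀ (j : Fin m) → ∃[ u ] u * (con θ ^ toℕ (suc j) - con K.1#) ≈ con K.1#
    con-separated j = con u , (begin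
      con u * (con θ ^ k - con K.1#)          ≈⟨ *-congˡ (+-cong (con-^-∼ θ k) (≈⇒∼ (con-⊖ K.1#))) ⟨
      con u * (con (θ K.^ k) + con (K.- K.1#)) ≈⟨ *-congˡ (≈⇒∼ (con-+ _ _)) ⟨
      con u * con (θ K.^ k K.- K.1#)          ≈⟨ ≈⇒∼ (con-* _ _) ⟨
      con (u K.* (θ K.^ k K.- K.1#))          ≈⟨ con-cong-∼ (proj₂ (θ^-separated j)) ⟩
      con K.1#                                ∎)
      where
      open import Relation.Binary.Reasoning.Setoid setoid
      k : ℕ
      k = toℕ (suc j)
      u : K.Carrier
      u = proj₁ (θ^-separated j)

  open RootsOfUnity.Projections quotientRing m con-ωθ≈1 con-θⁿ≈1 con-νn≈1 con-separated public

  projection-pow : ∀ (k : Fin (suc m)) {x} → x ^ suc m ≈ con K.1# →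
                   x * projection (toℕ k) x ≈ con (pow k) * projection (toℕ k) x
  projection-pow k xⁿ≈1 = trans (projection-eigen (toℕ k) xⁿ≈1)
    (*-congʳ (sym (con-^-∼ ω (toℕ k))))

  gridIdempotent-pow : (∀ i → var i ^ suc m ≈ con K.1#) → ∀ a i →
    var i * gridIdempotent var a ≈ con (pow (a i)) * gridIdempotent var a
  gridIdempotent-pow varⁿ≈1 a i = trans (gridIdempotent-eigen var varⁿ≈1 a i)
    (*-congʳ (sym (con-^-∼ ω (toℕ (a i)))))

-- The Hamiltonian ideal and its zeros, the tours.

module HamiltonianIdeal {c ℓ} (K : Field c ℓ) (m : ℕ) (ω : Field.Carrier K)
  (isPrimitive : PrimitiveRoot K (suc m) ω)
  (n≉0 : ¬ Field._≈_ K (Field._·_ K (suc m) (Field.1# K)) (Field.0# K))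
  (G : SimpleDigraph (suc m)) where

  private
    module K = Field K
    n : ℕ
    n = suc m
  open SimpleDigraph G
  open CycleSymmetries G
  open Roots K m ω isPrimitive
  open Polynomials K n using (Poly; con; var; polynomialRing)
  open Evaluation K n
  open Ideals K G ω
  open import Algebra.Definitions.RawSemiring (Semiring.rawSemiring (CommutativeRing.semiring polynomialRing)) using (_^_)

  private
    module P = CommutativeRing polynomialRing

    rootEquation : Fin n → Poly
    rootEquation i = var i ^ n P.- P.1#

    arcFactor : Fin n → Fin n → Poly
    arcFactor i j = con ω P.* var i P.- var j

    arcEquation : Fin n → Poly
    arcEquation i = foldr P._*_ P.1# (map (arcFactor i) (δ⁺ i))

    generators : List Poly
    generators = tabulate rootEquation ++ tabulate arcEquation

    open import Algebra.Properties.Group K.+-group using (x∙y⁻¹≈ε⇒x≈y; x≈y⇒x∙y⁻¹≈ε)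

    module _ (a : Fin n → Fin n) where

      rootEquation-vanishes : ∀ i → Vanishes (pow ∘ a) (rootEquation i)
      rootEquation-vanishes i =
        x≈y⇒x∙y⁻¹≈ε (K.trans (K.reflexive (eval-^ (pow ∘ a) (var i) n)) (pow^n≈1 (a i)))

      arcFactor-vanishes : ∀ i j → a j ≡ next (a i) → Vanishes (pow ∘ a) (arcFactor i j)
      arcFactor-vanishes i j eq =
        x≈y⇒x∙y⁻¹≈ε (K.trans (K.sym (pow-suc (a i))) (K.reflexive (cong pow (≡.sym eq))))

      arcFactor-vanishes⁻¹ : ∀ i j → Vanishes (pow ∘ a) (arcFactor i j) → a j ≡ next (a i)
      arcFactor-vanishes⁻¹ i j v =
        pow-injective (K.trans (K.sym (x∙y⁻¹≈ε⇒x≈y _ _ v)) (K.sym (pow-suc (a i))))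

      arcEquation-vanishes : Tour a → ∀ i → Vanishes (pow ∘ a) (arcEquation i)
      arcEquation-vanishes tour i = let j , arc , eq = tour i in
        vanishes-product (pow ∘ a) (arcFactor i) {δ⁺ i} (∈-filter⁺ (arc? i) (∈-allFin j) arc)
          (arcFactor-vanishes i j eq)

      arcEquation-nonvanishing : ∀ i → ¬ (∃[ j ] Arc i j × a j ≡ next (a i)) →
                                 ¬ Vanishes (pow ∘ a) (arcEquation i)
      arcEquation-nonvanishing i ¬followed =
        nonvanishing-product (pow ∘ a) (arcFactor i) {δ⁺ i} λ {j} j∈δ⁺ v →
          ¬followed (j , proj₂ (∈-filter⁻ (arc? i) {xs = allFin n} j∈δ⁺) , arcFactor-vanishes⁻¹ i j v)

      generators-vanish : Tour a → All (Vanishes (pow ∘ a)) generators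
      generators-vanish tour = All.++⁺ {xs = tabulate rootEquation}
        (All.tabulate⁺ {f = rootEquation} rootEquation-vanishes)
        (All.tabulate⁺ {f = arcEquation} (arcEquation-vanishes tour))

    follows? : (a : Fin n → Fin n) → ∀ i → Dec (∃[ j ] Arc i j × a j ≡ next (a i))
    follows? a i = any? λ j → arc? i j ×-dec a j ≟ next (a i)

  tour⇒vanishes : ∀ a → Tour a → ∀ {f} → hamiltonianIdeal f → Vanishes (pow ∘ a) f
  tour⇒vanishes a tour = vanishes-⟨⟩ (pow ∘ a) {generators} (All.lookup (generators-vanish a tour))

  -- A vanishing product in `K` does not reveal which factor vanishes. Having a suitable
  -- out-neighbour is decidable on labels, so it suffices to refute its absence.
  vanishes⇒tour : ∀ a → (∀ {f} → hamiltonianIdeal f → Vanishes (pow ∘ a) f) → Tour a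
  vanishes⇒tour a v i = decidable-stable (follows? a i) λ ¬followed →
    arcEquation-nonvanishing a i ¬followed
      (v (generator (∈-++⁺ʳ (tabulate rootEquation) (∈-tabulate⁺ {f = arcEquation} i))))

  open Localisation K n generators
  open GridAlgebra K m ω isPrimitive n≉0 generators
  open import Algebra.Definitions.RawSemiring (Semiring.rawSemiring semiring) using () renaming (_^_ to _^/_)

  -- By `gridSieve` each grid idempotent can be treated alone: at a tour `f` acts on it as 0, and
  -- elsewhere the idempotent is itself 0.
  vanishesOnTours⇒∈ : ∀ f → (∀ a → Tour a → Vanishes (pow ∘ a) f) → hamiltonianIdeal f
  vanishesOnTours⇒∈ f onTours = ∼0⇒∈ (gridSieve var f killed)
    where
    root : ∀ i → var i ^/ n ≈ con K.1#
    root i = trans (reflexive (^-quotient (var i) n)) (generator (∈-++⁺ˡ (∈-tabulate⁺ {f = rootEquation} i)))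

    arcEquation≈0 : ∀ i → arcEquation i ≈ con K.0#
    arcEquation≈0 i = ∈⇒∼0 (generator (∈-++⁺ʳ (tabulate rootEquation) (∈-tabulate⁺ {f = arcEquation} i)))

    killed : ∀ a → f * gridIdempotent var a ≈ con K.0#
    killed a = [ (λ tour → vanishing⇒killed {a = pow ∘ a} (gridIdempotent-pow root a) {f} (onTours a tour))
               , (λ ¬tour → let i , ¬followed = ¬∀⟶∃¬ n _ (follows? a) ¬tour in
                    trans (*-congˡ {x = f} (e≈0 i ¬followed)) (zeroʳ f))
               ]′ (toSum (all? (follows? a)))
      where
      -- The arc equation at `i` is 0 in the quotient, yet it acts on the idempotent as a nonzero
      -- constant.
      e≈0 : ∀ i → ¬ (∃[ j ] Arc i j × a j ≡ next (a i)) → gridIdempotent var a ≈ con K.0#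
      e≈0 i ¬followed = con-cancel (arcEquation-nonvanishing a i ¬followed)
        (trans (sym (localise {a = pow ∘ a} (gridIdempotent-pow root a) (arcEquation i)))
          (trans (*-congʳ (arcEquation≈0 i)) (zeroˡ _)))

-- The two kinds of cycle ideal and their zeros.

module CycleIdeals {c ℓ} (K : Field c ℓ) (m : ℕ) (ω : Field.Carrier K)
  (isPrimitive : PrimitiveRoot K (suc (suc m)) ω)
  (n≉0 : ¬ Field._≈_ K (Field._·_ K (suc (suc m)) (Field.1# K)) (Field.0# K))
  (G : SimpleDigraph (suc (suc m))) where

  private
    module K = Field K
    n : ℕ
    n = suc (suc m)
    top penult : Fin n
    top    = fromℕ (suc m)
    penult = inject₁ (fromℕ m)
  open Roots K (suc m) ω isPrimitive
  open Polynomials K n using (Poly; con; var; polynomialRing; con-+; con-*)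
  open Evaluation K n
  open Ideals K G ω
  open import Algebra.Properties.Group K.+-group using (x∙y⁻¹≈ε⇒x≈y; x≈y⇒x∙y⁻¹≈ε)

  private
    module P = CommutativeRing polynomialRing
    open import Algebra.Definitions.RawSemiring (Semiring.rawSemiring P.semiring) using (_^_)

  -- A Nullstellensatz for the points `pow ∘ a`. Comparing two ideals of this kind reduces to
  -- comparing two predicates on labellings.
  record VanishingIdeal (I : Pred Poly (c ⊔ ℓ)) (Z : (Fin n → Fin n) → Set) : Set (c ⊔ ℓ) where
    field
      vanishes : ∀ a → Z a → ∀ {f} → I f → Vanishes (pow ∘ a) f
      zeros    : ∀ a → (∀ {f} → I f → Vanishes (pow ∘ a) f) → Z a
      complete : ∀ f → (∀ a → Z a → Vanishes (pow ∘ a) f) → I f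

  -- `rotate c` sends the last index to c - 1, hence the choice c = `next k`.
  rotation-through : ∀ k → ∃[ b ] Rotation b × b top ≡ k
  rotation-through k = rotate (next k) , rotate-rotation (next k) , next-injective (begin
    next (rotate (next k) top)   ≡⟨ rotate-rotation (next k) top ⟨
    rotate (next k) (next top)   ≡⟨ cong (rotate (next k)) (next-fromℕ (suc m)) ⟩
    rotate (next k) zero         ≡⟨ rotate-zero (next k) ⟩
    next k                       ∎)
    where open ≡.≡-Reasoning

  reflection-through : ∀ k → ∃[ b ] Reflection b × b top ≡ k
  reflection-through k = rotate k ∘ opposite , rotation∘opposite {f = rotate k} (rotate-rotation k) ,
    ≡.trans (cong (rotate k) (opposite-involutive zero)) (rotate-zero k)

  module Enumerated {v l : Fin n → Fin n} (v∘l : ∀ i → v (l i) ≡ i) (l∘v : ∀ i → l (v i) ≡ i)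
    (2<n : 2 < n) where

    private
      x : Fin n → Poly
      x = var ∘ v

      rootEquation : Poly
      rootEquation = x top ^ n P.- P.1#

      rootEquation-vanishes : ∀ a → Vanishes (pow ∘ a) rootEquation
      rootEquation-vanishes a = x≈y⇒x∙y⁻¹≈ε
        (K.trans (K.reflexive (eval-^ (pow ∘ a) (x top) n)) (pow^n≈1 (a (v top))))

    module ProgressionKills (gs : List Poly) where
      open Localisation K n gs

      -- The hypotheses on `e` make every variable act on it as its value at `pow ∘ b ∘ l`; the
      -- inverse `l` of `v` carries positions on the cycle back to vertices.
      progression-kills : ∀ {β} → β K.^ n K.≈ K.1# → ∀ {b} → Progression β (pow ∘ b) → ∀ {e} →
        x top * e ≈ con (pow (b top)) * e →
        (∀ i → x (inject₁ i) * e ≈ con (β K.^ suc (toℕ i) K.* pow (b top)) * e) →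
        ∀ {f} → Vanishes (pow ∘ b ∘ l) f → f * e ≈ con K.0#
      progression-kills {β} βⁿ≈1 {b} prog {e} atTop below {f} =
        vanishing⇒killed {a = pow ∘ b ∘ l} (λ i →
          subst (λ j → var j * e ≈ con (pow (b (l i))) * e) (v∘l i) (eigen (l i))) {f}
        where
        eigen : ∀ t → x t * e ≈ con (pow (b t)) * e
        eigen t with view t
        ... | ‵fromℕ     = atTop
        ... | ‵inject₁ i = trans (below i) (*-congʳ (con-cong-∼ (K.sym
          (K.trans (progression⇒fromLast βⁿ≈1 {pow ∘ b} prog (inject₁ i))
            (K.reflexive (cong (λ k → β K.^ suc k K.* pow (b top)) (toℕ-inject₁ i)))))))

    module Directed where

      linear : Fin (suc m) → Poly
      linear j = x (inject₁ (opposite j)) P.- con (ω K.^ (n ∸ suc (toℕ j))) P.* x top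

      generators : List Poly
      generators = tabulate linear ++ rootEquation ∷ []

      open Localisation K n generators
      open GridAlgebra K (suc m) ω isPrimitive n≉0 generators
      open ProgressionKills generators
      open import Algebra.Definitions.RawSemiring (Semiring.rawSemiring semiring)
        using () renaming (_^_ to _^/_)

      private
        -- The generators run backwards through the cycle: at position `opposite j`, counted from 0,
        -- the exponent is that position plus one.
        exponent : ∀ (j : Fin (suc m)) → n ∸ suc (toℕ j) ≡ suc (toℕ (opposite j))
        exponent j = ≡.trans (ℕ.+-∸-assoc 1 (ℕ.≤-pred (toℕ<n j))) (cong suc (≡.sym (opposite-prop j)))

        linear≈ : ∀ i → x (inject₁ i) ≈ con (ω K.^ suc (toℕ i)) * x top
        linear≈ i = subst (λ k → x (inject₁ k) ≈ con (ω K.^ suc (toℕ k)) * x top) (opposite-involutive i)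
          (subst (λ e → x (inject₁ (opposite (opposite i))) ≈ con (ω K.^ e) * x top) (exponent (opposite i))
            (generator (∈-++⁺ˡ (∈-tabulate⁺ {f = linear} (opposite i)))))

        root : x top ^/ n ≈ con K.1#
        root = trans (reflexive (^-quotient (x top) n))
          (generator (∈-++⁺ʳ (tabulate linear) (here ≡.refl)))

        linear-vanishes : ∀ a → Rotation (a ∘ v) → ∀ j → Vanishes (pow ∘ a) (linear j)
        linear-vanishes a rot j = x≈y⇒x∙y⁻¹≈ε (K.trans
          (progression⇒fromLast (proj₁ isPrimitive) {pow ∘ a ∘ v}
            (rotation⇒progression {a ∘ v} rot) (inject₁ (opposite j)))
          (K.reflexive (cong (λ k → ω K.^ k K.* pow (a (v top)))
            (≡.trans (cong suc (toℕ-inject₁ (opposite j))) (≡.sym (exponent j))))))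

        generators-vanish : ∀ a → Rotation (a ∘ v) → All (Vanishes (pow ∘ a)) generators
        generators-vanish a rot = All.++⁺ {xs = tabulate linear}
          (All.tabulate⁺ {f = linear} (linear-vanishes a rot)) (rootEquation-vanishes a ∷ [])

        -- Where `x top` acts as ω^k the linear generators fix the other variables, and the
        -- resulting point is the rotation through `k`.
        killed : ∀ f → (∀ a → Rotation (a ∘ v) → Vanishes (pow ∘ a) f) →
                 ∀ k → f * projection (toℕ k) (x top) ≈ con K.0#
        killed f onZeros k with b , rot , ≡.refl ← rotation-through k =
          progression-kills (proj₁ isPrimitive) {b} (rotation⇒progression {b} rot) atTop below {f}
            (onZeros (b ∘ l) (rotation-resp-≗ (cong b ∘ ≡.sym ∘ l∘v) rot))
          where
          e = projection (toℕ (b top)) (x top)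
          atTop : x top * e ≈ con (pow (b top)) * e
          atTop = projection-pow (b top) root
          below : ∀ i → x (inject₁ i) * e ≈ con (ω K.^ suc (toℕ i) K.* pow (b top)) * e
          below i = begin
            x (inject₁ i) * e                                     ≈⟨ *-congʳ (linear≈ i) ⟩
            con (ω K.^ suc (toℕ i)) * x top * e                   ≈⟨ *-assoc _ _ e ⟩
            con (ω K.^ suc (toℕ i)) * (x top * e)                 ≈⟨ *-congˡ atTop ⟩
            con (ω K.^ suc (toℕ i)) * (con (pow (b top)) * e)     ≈⟨ con-*-assoc _ _ e ⟨
            con (ω K.^ suc (toℕ i) K.* pow (b top)) * e           ∎
            where open import Relation.Binary.Reasoning.Setoid setoid

      vanishingIdeal : VanishingIdeal (⟨_⟩ polynomialRing generators) (λ a → Rotation (a ∘ v))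
      vanishingIdeal = record
        { vanishes = λ a rot → vanishes-⟨⟩ (pow ∘ a) {generators} (All.lookup (generators-vanish a rot))
        ; zeros    = λ a van → progression⇒rotation {a ∘ v}
            (fromLast⇒progression (proj₁ isPrimitive) {pow ∘ a ∘ v} λ i →
            -- An equation of the quotient ring is by definition a membership in the ideal, so `van`
            -- applies to it.
            x∙y⁻¹≈ε⇒x≈y _ _ (van (linear≈ i)))
        ; complete = λ f onZeros → ∼0⇒∈ (sieve (x top) f (killed f onZeros))
        }

    module Doubly where

      -- The two ways x_{v_i} = β ^ i x_{v_k} of solving the generators.
      record Direction : Set (c ⊔ ℓ) where
        field
          β γ   : K.Carrier
          βγ≈1  : β K.* γ K.≈ K.1#
          βⁿ≈1  : β K.^ n K.≈ K.1#
          solve : ∀ j → β K.^ suc j K.+ A 2<n j K.* γ K.+ B 2<n j K.≈ K.0#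

        γ≈β^[n-1] : γ K.≈ β K.^ suc m
        γ≈β^[n-1] = begin
          γ                           ≈⟨ K.*-identityʳ γ ⟨
          γ K.* K.1#                  ≈⟨ K.*-congˡ βⁿ≈1 ⟨
          γ K.* (β K.* β K.^ suc m)   ≈⟨ K.*-assoc γ β _ ⟨
          γ K.* β K.* β K.^ suc m     ≈⟨ K.*-congʳ (K.trans (K.*-comm γ β) βγ≈1) ⟩
          K.1# K.* β K.^ suc m        ≈⟨ K.*-identityˡ _ ⟩
          β K.^ suc m                 ∎
          where open import Relation.Binary.Reasoning.Setoid K.setoid

        solve-scaled : ∀ j t → β K.^ suc j K.* t K.+ A 2<n j K.* (γ K.* t) K.+ B 2<n j K.* t K.≈ K.0#
        solve-scaled j t = begin
          β K.^ suc j K.* t K.+ A 2<n j K.* (γ K.* t) K.+ B 2<n j K.* t   ≈⟨ K.+-congʳ (K.+-congˡ (K.*-assoc _ γ t)) ⟨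
          β K.^ suc j K.* t K.+ A 2<n j K.* γ K.* t K.+ B 2<n j K.* t     ≈⟨ K.+-congʳ (K.distribʳ t _ _) ⟨
          (β K.^ suc j K.+ A 2<n j K.* γ) K.* t K.+ B 2<n j K.* t         ≈⟨ K.distribʳ t _ _ ⟨
          (β K.^ suc j K.+ A 2<n j K.* γ K.+ B 2<n j) K.* t               ≈⟨ K.*-congʳ (solve j) ⟩
          K.0# K.* t                                                      ≈⟨ K.zeroˡ t ⟩
          K.0#                                                            ∎
          where open import Relation.Binary.Reasoning.Setoid K.setoid

        module _ {q : Fin n → K.Carrier} where

          progression⇒penult : Progression β q → q penult K.≈ γ K.* q top
          progression⇒penult prog = begin
            q penult                        ≈⟨ progression⇒fromLast βⁿ≈1 {q} prog penult ⟩
            β K.^ suc (toℕ penult) K.* q top ≡⟨ cong (λ k → β K.^ suc k K.* q top)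
                                                  (≡.trans (toℕ-inject₁ (fromℕ m)) (toℕ-fromℕ m)) ⟩
            β K.^ suc m K.* q top           ≈⟨ K.*-congʳ γ≈β^[n-1] ⟨
            γ K.* q top                     ∎
            where open import Relation.Binary.Reasoning.Setoid K.setoid

          progression⇒linear : Progression β q → ∀ (j : Fin m) →
            q (inject₁ (inject₁ j)) K.+ A 2<n (toℕ j) K.* q penult K.+ B 2<n (toℕ j) K.* q top K.≈ K.0#
          progression⇒linear prog j = K.trans
            (K.+-congʳ (K.+-cong (K.trans (progression⇒fromLast βⁿ≈1 {q} prog (inject₁ (inject₁ j)))
                (K.reflexive (cong (λ k → β K.^ suc k K.* q top) (≡.trans (toℕ-inject₁ (inject₁ j)) (toℕ-inject₁ j)))))
              (K.*-congˡ (progression⇒penult prog))))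
            (solve-scaled (toℕ j) (q top))

          linear⇒progression : q penult K.≈ γ K.* q top →
            (∀ (j : Fin m) → q (inject₁ (inject₁ j)) K.+ A 2<n (toℕ j) K.* q penult
                             K.+ B 2<n (toℕ j) K.* q top K.≈ K.0#) →
            Progression β q
          linear⇒progression atPenult eqs = fromLast⇒progression βⁿ≈1 {q} below
            where
            open import Relation.Binary.Reasoning.Setoid K.setoid
            open import Algebra.Properties.Group K.+-group using (∙-cancelʳ)
            below : ∀ i → q (inject₁ i) K.≈ β K.^ suc (toℕ i) K.* q top
            below i with view i
            ... | ‵fromℕ = begin
              q penult                                 ≈⟨ atPenult ⟩
              γ K.* q top                              ≈⟨ K.*-congʳ γ≈β^[n-1] ⟩
              β K.^ suc m K.* q top                    ≡⟨ cong (λ k → β K.^ suc k K.* q top) (toℕ-fromℕ m) ⟨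
              β K.^ suc (toℕ (fromℕ m)) K.* q top      ∎
            ... | ‵inject₁ j = ∙-cancelʳ _ _ _ (∙-cancelʳ _ _ _ (begin
              q (inject₁ (inject₁ j)) K.+ A 2<n (toℕ j) K.* q penult K.+ B 2<n (toℕ j) K.* q top
                ≈⟨ eqs j ⟩
              K.0#
                ≈⟨ solve-scaled (toℕ j) (q top) ⟨
              β K.^ suc (toℕ j) K.* q top K.+ A 2<n (toℕ j) K.* (γ K.* q top) K.+ B 2<n (toℕ j) K.* q top
                ≈⟨ K.+-congʳ (K.+-cong
                     (K.reflexive (cong (λ k → β K.^ suc k K.* q top) (toℕ-inject₁ j)))
                     (K.*-congˡ atPenult)) ⟨
              β K.^ suc (toℕ (inject₁ j)) K.* q top K.+ A 2<n (toℕ j) K.* q penult K.+ B 2<n (toℕ j) K.* q top ∎))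

      forward backward : Direction
      forward = record
        { β = ω ; γ = θ ; βγ≈1 = ωθ≈1 ; βⁿ≈1 = proj₁ isPrimitive ; solve = linearRelation-ω 2<n }
      backward = record
        { β = θ ; γ = ω ; βγ≈1 = θω≈1 ; βⁿ≈1 = θⁿ≈1 ; solve = linearRelation-θ 2<n }

      linear : Fin m → Poly
      linear j = x (inject₁ (inject₁ j)) P.+ con (A 2<n (toℕ j)) P.* x penult P.+ con (B 2<n (toℕ j)) P.* x top

      quadratic : Poly
      quadratic = (x penult P.- con ω P.* x top) P.* (x penult P.- con θ P.* x top)

      generators : List Poly
      generators = tabulate linear ++ quadratic ∷ rootEquation ∷ []

      Z : (Fin n → Fin n) → Set
      Z a = Rotation (a ∘ v) ⊎ Reflection (a ∘ v)

      private
        module _ (a : Fin n → Fin n) where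

          q : Fin n → K.Carrier
          q = pow ∘ a ∘ v

          quadratic-vanishes : Z a → Vanishes (pow ∘ a) quadratic
          quadratic-vanishes (inj₁ rot) = K.trans (K.*-congˡ (x≈y⇒x∙y⁻¹≈ε
            (Direction.progression⇒penult forward {q} (rotation⇒progression {a ∘ v} rot)))) (K.zeroʳ _)
          quadratic-vanishes (inj₂ ref) = K.trans (K.*-congʳ (x≈y⇒x∙y⁻¹≈ε
            (Direction.progression⇒penult backward {q} (reflection⇒progression {a ∘ v} ref)))) (K.zeroˡ _)

          linear-vanishes : Z a → ∀ j → Vanishes (pow ∘ a) (linear j)
          linear-vanishes (inj₁ rot) = Direction.progression⇒linear forward {q} (rotation⇒progression {a ∘ v} rot)
          linear-vanishes (inj₂ ref) = Direction.progression⇒linear backward {q} (reflection⇒progression {a ∘ v} ref)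

          generators-vanish : Z a → All (Vanishes (pow ∘ a)) generators
          generators-vanish z = All.++⁺ {xs = tabulate linear}
            (All.tabulate⁺ {f = linear} (linear-vanishes z)) (quadratic-vanishes z ∷ rootEquation-vanishes a ∷ [])

          -- The two candidate equations are tested on labels; if both fail, both factors of the
          -- quadratic are nonzero, and so is their product.
          penult-cases : Vanishes (pow ∘ a) quadratic → q penult K.≈ ω K.* q top ⊎ q penult K.≈ θ K.* q top
          penult-cases van with a (v penult) ≟ next (a (v top)) | next (a (v penult)) ≟ a (v top)
          ... | yes eq | _      = inj₁ (K.trans (K.reflexive (cong pow eq)) (pow-suc (a (v top))))
          ... | no  _  | yes eq = inj₂ (K.trans (K.sym (θω-cancel _)) (K.*-congˡ
            (K.trans (K.sym (pow-suc (a (v penult)))) (K.reflexive (cong pow eq)))))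
          ... | no ¬ω  | no ¬θ  = contradiction van (FieldProperties.*-nonzero K
            (FieldProperties.x≉y⇒x-y≉0 K λ eq → ¬ω (pow-injective (K.trans eq (K.sym (pow-suc (a (v top)))))))
            (FieldProperties.x≉y⇒x-y≉0 K λ eq → ¬θ (pow-injective (K.trans (pow-suc (a (v penult)))
              (K.trans (K.*-congˡ eq) (ωθ-cancel _))))))

          -- The roots cross over: the last but one value is ω times the last exactly when a forward
          -- step multiplies by ω⁻¹.
          penult⇒Z : (∀ j → Vanishes (pow ∘ a) (linear j)) →
                     q penult K.≈ ω K.* q top ⊎ q penult K.≈ θ K.* q top → Z a
          penult⇒Z van (inj₁ eq) = inj₂ (progression⇒reflection {a ∘ v} (Direction.linear⇒progression backward {q} eq van))
          penult⇒Z van (inj₂ eq) = inj₁ (progression⇒rotation {a ∘ v} (Direction.linear⇒progression forward {q} eq van))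

      open Localisation K n generators
      open GridAlgebra K (suc m) ω isPrimitive n≉0 generators
      open ProgressionKills generators
      open import Algebra.Definitions.RawSemiring (Semiring.rawSemiring semiring)
        using () renaming (_^_ to _^/_)
      open import Algebra.Properties.Ring ring using (-‿distribˡ-*)
      open import Algebra.Properties.Group +-group using (∙-cancelʳ)
      open import Algebra.Properties.CommutativeSemigroup *-commutativeSemigroup using (x∙yz≈y∙xz)
      open import Relation.Binary.Reasoning.Setoid setoid

      private
        ∈-linear : ∀ j → linear j ∈ generators
        ∈-linear j = ∈-++⁺ˡ (∈-tabulate⁺ {f = linear} j)

        ∈-quadratic : quadratic ∈ generators
        ∈-quadratic = ∈-++⁺ʳ (tabulate linear) (here ≡.refl)

        root : x top ^/ n ≈ con K.1#
        root = trans (reflexive (^-quotient (x top) n))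
          (generator (∈-++⁺ʳ (tabulate linear) (there (here ≡.refl))))

        module _ (d : Direction) {κ : K.Carrier} {e : Poly} (atTop : x top * e ≈ con κ * e)
          (atPenult : x penult * e ≈ con (Direction.γ d K.* κ) * e) where
          open Direction d

          below : ∀ i → x (inject₁ i) * e ≈ con (β K.^ suc (toℕ i) K.* κ) * e
          below i with view i
          ... | ‵fromℕ = trans atPenult (*-congʳ (con-cong-∼ (K.*-congʳ
            (K.trans γ≈β^[n-1] (K.reflexive (cong (λ k → β K.^ suc k) (≡.sym (toℕ-fromℕ m))))))))
          -- The linear generator and `solve-scaled` both give 0 and share their last two terms on
          -- `e`; cancelling these leaves the first.
          ... | ‵inject₁ j = ∙-cancelʳ _ _ _ (∙-cancelʳ _ _ _ (begin
            x (inject₁ (inject₁ j)) * e + con (Aⱼ K.* (γ K.* κ)) * e + con (Bⱼ K.* κ) * e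
              ≈⟨ +-cong (+-congˡ (scaled Aⱼ atPenult)) (scaled Bⱼ atTop) ⟨
            x (inject₁ (inject₁ j)) * e + con Aⱼ * x penult * e + con Bⱼ * x top * e
              ≈⟨ distribʳ₃ _ _ _ ⟨
            linear j * e
              ≈⟨ *-congʳ (∈⇒∼0 (generator (∈-linear j))) ⟩
            con K.0# * e
              ≈⟨ *-congʳ (con-cong-∼ (K.trans (K.+-congʳ (K.+-congʳ (K.*-congʳ
                   (K.reflexive (cong (λ k → β K.^ suc k) (toℕ-inject₁ j)))))) (solve-scaled (toℕ j) κ))) ⟨
            con (βⱼ K.* κ K.+ Aⱼ K.* (γ K.* κ) K.+ Bⱼ K.* κ) * e
              ≈⟨ *-congʳ (trans (≈⇒∼ (con-+ _ _)) (+-congʳ (≈⇒∼ (con-+ _ _)))) ⟩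
            (con (βⱼ K.* κ) + con (Aⱼ K.* (γ K.* κ)) + con (Bⱼ K.* κ)) * e
              ≈⟨ distribʳ₃ _ _ _ ⟩
            con (βⱼ K.* κ) * e + con (Aⱼ K.* (γ K.* κ)) * e + con (Bⱼ K.* κ) * e ∎))
            where
            Aⱼ Bⱼ βⱼ : K.Carrier
            Aⱼ = A 2<n (toℕ j)
            Bⱼ = B 2<n (toℕ j)
            βⱼ = β K.^ suc (toℕ (inject₁ j))
            distribʳ₃ : ∀ p q r → (p + q + r) * e ≈ p * e + q * e + r * e
            distribʳ₃ p q r = trans (distribʳ e (p + q) r) (+-congʳ (distribʳ e p q))
            scaled : ∀ s {p c} → p * e ≈ con c * e → con s * p * e ≈ con (s K.* c) * e
            scaled s {p} {c} eq = trans (*-assoc _ p e) (trans (*-congˡ eq) (sym (con-*-assoc s c e)))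

        module _ {κ : K.Carrier} {e : Poly} (atTop : x top * e ≈ con κ * e) where

          atTop-multiple : ∀ g → x top * (g * e) ≈ con κ * (g * e)
          atTop-multiple g = trans (x∙yz≈y∙xz _ g e) (trans (*-congˡ atTop) (x∙yz≈y∙xz g _ e))

          factor-atTop : ∀ σ → (x penult - con σ * x top) * e ≈ (x penult - con (σ K.* κ)) * e
          factor-atTop σ = begin
            (x penult - con σ * x top) * e            ≈⟨ distribʳ e _ _ ⟩
            x penult * e + - (con σ * x top) * e      ≈⟨ +-congˡ (-‿distribˡ-* _ e) ⟨
            x penult * e - con σ * x top * e          ≈⟨ +-congˡ (-‿cong (trans (*-assoc _ _ e)
                                                           (trans (*-congˡ atTop) (sym (con-*-assoc σ κ e))))) ⟩
            x penult * e - con (σ K.* κ) * e          ≈⟨ +-congˡ (-‿distribˡ-* _ e) ⟩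
            x penult * e + - con (σ K.* κ) * e        ≈⟨ distribʳ e _ _ ⟨
            (x penult - con (σ K.* κ)) * e            ∎

        -- On `e` the quadratic splits into x penult - ρκ and x penult - σκ, so the multiple of `e`
        -- by the second factor is killed by the first.
        other-root : ∀ {κ e} → x top * e ≈ con κ * e → ∀ ρ σ →
          (x penult - con ρ * x top) * (x penult - con σ * x top) ≈ con K.0# →
          x penult * ((x penult - con (σ K.* κ)) * e) ≈ con (ρ K.* κ) * ((x penult - con (σ K.* κ)) * e)
        other-root {κ} {e} atTop ρ σ quad≈0 = killed⇒eigen (begin
          (x penult - con (ρ K.* κ)) * ((x penult - con (σ K.* κ)) * e)
            ≈⟨ factor-atTop (atTop-multiple atTop (x penult - con (σ K.* κ))) ρ ⟨
          (x penult - con ρ * x top) * ((x penult - con (σ K.* κ)) * e)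
            ≈⟨ *-congˡ (factor-atTop atTop σ) ⟨
          (x penult - con ρ * x top) * ((x penult - con σ * x top) * e)
            ≈⟨ *-assoc _ _ e ⟨
          (x penult - con ρ * x top) * (x penult - con σ * x top) * e
            ≈⟨ *-congʳ quad≈0 ⟩
          con K.0# * e
            ≈⟨ zeroˡ e ⟩
          con K.0# ∎)

        -- Multiplying by the factor of ωκ leaves the root θκ, which belongs to a rotation;
        -- multiplying by that of θκ leaves ωκ, a reflection. `f` vanishes at both points.
        directions-kill : ∀ f → (∀ a → Z a → Vanishes (pow ∘ a) f) → ∀ k {e} →
          x top * e ≈ con (pow k) * e →
          f * ((x penult - con (ω K.* pow k)) * e) ≈ con K.0# × f * ((x penult - con (θ K.* pow k)) * e) ≈ con K.0#
        directions-kill f onZeros k {e} atTop = viaRotation , viaReflection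
          where
          quadratic≈0 : quadratic ≈ con K.0#
          quadratic≈0 = ∈⇒∼0 (generator ∈-quadratic)

          viaRotation : f * ((x penult - con (ω K.* pow k)) * e) ≈ con K.0#
          viaRotation with b , rot , ≡.refl ← rotation-through k =
            progression-kills (Direction.βⁿ≈1 forward) {b} (rotation⇒progression {b} rot)
              (atTop-multiple atTop _)
              (below forward (atTop-multiple atTop _) (other-root atTop θ ω (trans (*-comm _ _) quadratic≈0)))
              {f} (onZeros (b ∘ l) (inj₁ (rotation-resp-≗ (cong b ∘ ≡.sym ∘ l∘v) rot)))

          viaReflection : f * ((x penult - con (θ K.* pow k)) * e) ≈ con K.0#
          viaReflection with b , ref , ≡.refl ← reflection-through k =
            progression-kills (Direction.βⁿ≈1 backward) {b} (reflection⇒progression {b} ref)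
              (atTop-multiple atTop _)
              (below backward (atTop-multiple atTop _) (other-root atTop ω θ quadratic≈0))
              {f} (onZeros (b ∘ l) (inj₂ (reflection-resp-≗ (cong b ∘ ≡.sym ∘ l∘v) ref)))

        -- Otherwise two steps of `next` would fix `k`.
        ωκ≉θκ : ∀ k → ¬ ω K.* pow k K.≈ θ K.* pow k
        ωκ≉θκ k eq = next²-fixpointFree 2<n k (pow-injective
          (K.trans (pow-suc (next k)) (K.trans (K.*-congˡ (K.trans (pow-suc k) eq)) (ωθ-cancel (pow k)))))

        -- `f * e` is an eigenvector of multiplication by `x penult` for the two distinct values ωκ
        -- and θκ, hence zero.
        killed : ∀ f → (∀ a → Z a → Vanishes (pow ∘ a) f) →
                 ∀ k → f * projection (toℕ k) (x top) ≈ con K.0#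
        killed f onZeros k = con-cancel (FieldProperties.x≉y⇒x-y≉0 K (ωκ≉θκ k)) (begin
          con (ω K.* pow k K.- θ K.* pow k) * (f * e)
            ≈⟨ *-congʳ (trans (≈⇒∼ (con-+ _ _)) (+-congˡ (≈⇒∼ (con-⊖ _)))) ⟩
          (con (ω K.* pow k) - con (θ K.* pow k)) * (f * e)
            ≈⟨ eigen⇒killed (trans (sym (atPenult ω (proj₁ kills))) (atPenult θ (proj₂ kills))) ⟩
          con K.0# ∎)
          where
          e : Poly
          e = projection (toℕ k) (x top)
          kills : f * ((x penult - con (ω K.* pow k)) * e) ≈ con K.0#
                × f * ((x penult - con (θ K.* pow k)) * e) ≈ con K.0#
          kills = directions-kill f onZeros k (projection-pow k root)
          atPenult : ∀ σ → f * ((x penult - con (σ K.* pow k)) * e) ≈ con K.0# →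
                     x penult * (f * e) ≈ con (σ K.* pow k) * (f * e)
          atPenult σ eq = killed⇒eigen (trans (x∙yz≈y∙xz _ f e) eq)

      vanishingIdeal : VanishingIdeal (⟨_⟩ polynomialRing generators) Z
      vanishingIdeal = record
        { vanishes = λ a z → vanishes-⟨⟩ (pow ∘ a) {generators} (All.lookup (generators-vanish a z))
        ; zeros    = λ a van → penult⇒Z a (λ j → van (generator (∈-linear j)))
            (penult-cases a (van (generator ∈-quadratic)))
        ; complete = λ f onZeros → ∼0⇒∈ (sieve (x top) f (killed f onZeros))
        }

-- Comparison of the Hamiltonian ideal with the cycle ideals.

module CycleIdealsOfCycles {c ℓ} (K : Field c ℓ) (m : ℕ) (ω : Field.Carrier K)
  (isPrimitive : PrimitiveRoot K (suc (suc m)) ω)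
  (n≉0 : ¬ Field._≈_ K (Field._·_ K (suc (suc m)) (Field.1# K)) (Field.0# K))
  (G : SimpleDigraph (suc (suc m))) where

  private
    n : ℕ
    n = suc (suc m)
  open CycleSymmetries G
  open CycleIdeals K m ω isPrimitive n≉0 G
  open HamiltonianIdeal K (suc m) ω isPrimitive n≉0 G
  open Ideals K G ω
  open Polynomials K n using (Poly; polynomialRing)
  open Cycle

  hamiltonianIdeal-vanishing : VanishingIdeal hamiltonianIdeal Tour
  hamiltonianIdeal-vanishing = record
    { vanishes = tour⇒vanishes
    ; zeros    = vanishes⇒tour
    ; complete = vanishesOnTours⇒∈
    }

  module _ {I J : Pred Poly (c ⊔ ℓ)} {Z W : (Fin n → Fin n) → Set}
    (vI : VanishingIdeal I Z) (vJ : VanishingIdeal J W) where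
    private
      module I = VanishingIdeal vI
      module J = VanishingIdeal vJ

    zeros⊆⇒ideal⊇ : (∀ a → Z a → W a) → J ⊆ I
    zeros⊆⇒ideal⊇ Z⊆W {f} f∈J = I.complete f λ a z → J.vanishes a (Z⊆W a z) f∈J

    ideal⊇⇒zeros⊆ : J ⊆ I → ∀ a → Z a → W a
    ideal⊇⇒zeros⊆ J⊆I a z = J.zeros a λ f∈J → I.vanishes a z (J⊆I f∈J)

  vanishingIdeal-resp : ∀ {I Z W} → (∀ a → Z a → W a) → (∀ a → W a → Z a) →
                        VanishingIdeal I Z → VanishingIdeal I W
  vanishingIdeal-resp Z⊆W W⊆Z vI = record
    { vanishes = λ a w → I.vanishes a (W⊆Z a w)
    ; zeros    = λ a van → Z⊆W a (I.zeros a van)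
    ; complete = λ f onZeros → I.complete f (λ a z → onZeros a (Z⊆W a z))
    }
    where module I = VanishingIdeal vI

  cycleIdeal-vanishing : ∀ C → VanishingIdeal (cycleIdeal C) (λ a → Symmetry C (a ∘ vertex C))
  cycleIdeal-vanishing C = byCase (2<k C) (doublyCovered? G C)
    where
    -- The bound and the decision are generalised together so that matching on them lets the
    -- generator lists compute.
    byCase : (2<n : 2 < n) (dc? : Dec (DoublyCovered G C)) → VanishingIdeal
      (⟨_⟩ polynomialRing (if does dc? then doublyCoveredGenerators 2<n (vertex C)
                                       else directedGenerators 2<n (vertex C)))
      (λ a → Symmetry C (a ∘ vertex C))
    byCase 2<n@(s≤s (s≤s _)) (yes dc) = vanishingIdeal-resp
      (λ a → ⊎-map₂ (dc ,_)) (λ a → ⊎-map₂ proj₂)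
      (Enumerated.Doubly.vanishingIdeal (vertex-label C) (label-vertex C) 2<n)
    byCase 2<n@(s≤s (s≤s _)) (no ¬dc) = vanishingIdeal-resp
      (λ a → inj₁) (λ a → [ id , (λ (dc , _) → contradiction dc ¬dc) ]′)
      (Enumerated.Directed.vanishingIdeal (vertex-label C) (label-vertex C) 2<n)

  -- Inclusions of ideals are reversed inclusions of zeros: symmetries of any `C` are tours, and
  -- `Unique C` makes every tour a symmetry.
  unique⇒ideal : ∀ C → Unique C → hamiltonianIdeal ≐ cycleIdeal C
  unique⇒ideal C unique =
      zeros⊆⇒ideal⊇ (cycleIdeal-vanishing C) hamiltonianIdeal-vanishing (λ a → symmetry-tour C {a})
    , zeros⊆⇒ideal⊇ hamiltonianIdeal-vanishing (cycleIdeal-vanishing C) (unique⇒symmetry C unique)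

  -- `label D` is a tour, so a zero of the Hamiltonian ideal and hence of the cycle ideal of `C`;
  -- being such a zero is the symmetry sought.
  ideal⇒unique : ∀ C → hamiltonianIdeal ≐ cycleIdeal C → Unique C
  ideal⇒unique C (_ , ideal⊇) D =
    ideal⊇⇒zeros⊆ hamiltonianIdeal-vanishing (cycleIdeal-vanishing C) ideal⊇ (label D) (label-tour D)

corollary3p10 : ∀ {c ℓ} (K : Field c ℓ) → AlgebraicallyClosed K →
    (n : ℕ) → 3 ≤ n →
    (G : SimpleDigraph n) → SimpleDigraph.Connected G →
    (∀ p → HasCharacteristic K p → p ≡ 0 ⊎ Coprime p n) →
    (ω : Field.Carrier K) → PrimitiveRoot K n ω →
    UniquelyHamiltonian G
    ⇔ (∃[ C ] Ideals.hamiltonianIdeal K G ω ≐ Ideals.cycleIdeal K G ω C)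
corollary3p10 K _ (suc (suc m)) (s≤s (s≤s _)) G _ coprime ω isPrimitive = mk⇔
  (λ uh → let C , unique = uniquelyHamiltonian⇒unique uh in C , unique⇒ideal C unique)
  (λ (C , ideal) → unique⇒uniquelyHamiltonian C (ideal⇒unique C ideal))
  where
  open CycleSymmetries G
  -- The condition on the characteristic provides the inverse of n in the Lagrange projections.
  open CycleIdealsOfCycles K m ω isPrimitive (FieldProperties.n·1≉0 K z<s coprime) G
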